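{- Assume that $\kappa=\mathfrak{s}=\mathfrak{b}$ and that $P(\kappa)$ holds. Then there is a weakly tight family $\mathscr{A}\subset[\omega]^{\omega}$ of size $\mathfrak{c}$. In particular, weakly tight families of size $\mathfrak{c}$ exist if $\mathfrak{s}\leq\mathfrak{b}<\aleph_\omega$, and in particular, when $\mathfrak{s}=\omega_1$.
   Context: We work in ZFC. $[\omega]^{\omega}$ is the set of infinite subsets of $\omega$, $[\kappa]^{\kappa}$ is the set of subsets of $\kappa$ of size $\kappa$, $\mathfrak{c}=2^{\aleph_0}$, and $\exists^{\infty} n$ means "for infinitely many $n\in\omega$". $\mathfrak{b}$ is the bounding number (least size of an unbounded family in $\omega^{\omega}$ under eventual domination). $\mathfrak{s}$ is the splitting number: the least size of a family $\{e_\alpha:\alpha<\lambda\}\subset[\omega]^{\omega}$ such that for every $b\in[\omega]^{\omega}$ there is $\alpha$ with $|b\cap e_\alpha|=|b\cap(\omega\setminus e_\alpha)|=\omega$. For a cardinal $\kappa>\omega$, $P(\kappa)$ is the following principle: there is a sequence $\langle u_\alpha:\omega\leq\alpha<\kappa\rangle$ such that (1) $u_\alpha\subset\alpha$ and $|u_\alpha|=\omega$ for each $\omega\le\alpha<\kappa$; and (2) for every $\{X_n:n\in\omega\}\subset[\kappa]^{\kappa}$ there is $\alpha$ with $\omega\leq\alpha<\kappa$ such that $\exists^{\infty}n\in\omega\,(u_\alpha\cap X_n\neq\emptyset)$. A family $\mathscr{A}\subset[\omega]^{\omega}$ is almost disjoint (a.d.) if any two distinct members have finite intersection. $\mathcal{I}(\mathscr{A})$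 is the ideal on $\omega$ generated by $\mathscr{A}$ (ideals on $\omega$ contain all finite sets, so $x\in\mathcal{I}(\mathscr{A})$ iff $x\setminus\bigcup\mathcal{F}$ is finite for some finite $\mathcal{F}\subset\mathscr{A}$), and $\mathcal{I}^{+}(\mathscr{A})=\mathcal{P}(\omega)\setminus\mathcal{I}(\mathscr{A})$. An a.d. family $\mathscr{A}\subset[\omega]^{\omega}$ is weakly tight if for every countable collection $\{b_n : n\in\omega\}\subset\mathcal{I}^{+}(\mathscr{A})$ there is $a\in\mathscr{A}$ such that $\exists^{\infty} n\in\omega\,(|b_n\cap a|=\omega)$. -}

module Defs where

open import Axiom.ExcludedMiddle using (ExcludedMiddle)
open import Axiom.Extensionality.Propositional using (Extensionality)
open import Data.Bool using (Bool; T; not; _∧_; _∨_; false)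
open import Data.List using (List; foldr)
open import Data.List.Relation.Unary.All using (All)
open import Data.Nat using (ℕ; zero; suc; _≤_)
open import Data.Product using (Σ; ∃-syntax; _×_)
open import Function.Bundles using (_↔_; _↣_)
open import Induction.WellFounded using (WellFounded)
open import Level using (0ℓ; Lift) renaming (suc to lsuc)
open import Relation.Binary.Structures using (IsStrictTotalOrder)
open import Relation.Binary.PropositionalEquality using (_≡_; _≢_)
open import Relation.Nullary using (¬_)

-- The classical metatheory.  Since `Dec P` carries an element of P when P is
-- inhabited, excluded middle for all types is also a global choice operator;
-- with function extensionality it yields the axiom of choice and the
-- well-ordering theorem for the sets considered here.  Level 1 is used because
-- statements quantifying over all cardinals live in Set₁; the level-0
-- instances follow.

record Classical : Set (lsuc (lsuc 0ℓ)) where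
  field
    excludedMiddle : ExcludedMiddle (lsuc 0ℓ)
    extensionality : Extensionality (lsuc 0ℓ) (lsuc 0ℓ)

-- Subsets are Bool-valued, so that (classically) two subsets with the same
-- elements are propositionally equal, 𝒫 ℕ has exactly 2^ℵ₀ elements, and
-- membership is proof-irrelevant, whence ⟦ A ⟧ has exactly one element for
-- each element of A.

𝒫 : Set → Set
𝒫 X = X → Bool

infix 4 _∈_
infixr 7 _∩_
infixr 6 _∪_

_∈_ : {X : Set} → X → 𝒫 X → Set
x ∈ A = T (A x)

⟦_⟧ : {X : Set} → 𝒫 X → Set
⟦_⟧ {X} A = Σ X (λ x → x ∈ A)

∅ : {X : Set} → 𝒫 X
∅ x = false

_∩_ _∪_ _∖_ : {X : Set} → 𝒫 X → 𝒫 X → 𝒫 X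
(A ∩ B) x = A x ∧ B x
(A ∪ B) x = A x ∨ B x
(A ∖ B) x = A x ∧ not (B x)

∁ : {X : Set} → 𝒫 X → 𝒫 X
∁ A x = not (A x)

⋃ : {X : Set} → List (𝒫 X) → 𝒫 X
⋃ = foldr _∪_ ∅

Nonempty : {X : Set} → 𝒫 X → Set
Nonempty A = ∃[ x ] x ∈ A

∃^∞ : (ℕ → Set) → Set
∃^∞ Q = ∀ m → ∃[ n ] m ≤ n × Q n

∀^∞ : (ℕ → Set) → Set
∀^∞ Q = ∃[ m ] ∀ n → m ≤ n → Q n

Infinite Finite : 𝒫 ℕ → Set
Infinite a = ∃^∞ (λ n → n ∈ a)
Finite   a = ∀^∞ (λ n → ¬ (n ∈ a))

-- Cardinals are initial ordinals: well-orders that do not inject into any of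
-- their proper initial segments.  As with von Neumann ordinals, an element α
-- is identified with the set `below α` of its predecessors.

record Cardinal : Set₁ where
  field
    Carrier : Set
    below   : Carrier → 𝒫 Carrier

  _<_ : Carrier → Carrier → Set
  β < α = β ∈ below α

  field
    isStrictTotalOrder : IsStrictTotalOrder _≡_ _<_
    wellFounded        : WellFounded _<_
    initial            : ∀ α → ¬ (Carrier ↣ ⟦ below α ⟧)

open Cardinal public using (Carrier; below)

infix 4 _≤ᶜ_ _<ᶜ_

_≤ᶜ_ _<ᶜ_ : Cardinal → Cardinal → Set
κ ≤ᶜ μ = Carrier κ ↣ Carrier μ
κ <ᶜ μ = κ ≤ᶜ μ × ¬ (μ ≤ᶜ κ)

-- κ is the least size of a family F ⊆ X with property Q.
IsLeastSize : {X : Set} → (𝒫 X → Set) → Cardinal → Set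
IsLeastSize Q κ =
  (∃[ F ] Q F × (⟦ F ⟧ ↔ Carrier κ)) × (∀ F → Q F → Carrier κ ↣ ⟦ F ⟧)

_≤*_ : (ℕ → ℕ) → (ℕ → ℕ) → Set
f ≤* g = ∀^∞ (λ n → f n ≤ g n)

Unbounded : 𝒫 (ℕ → ℕ) → Set
Unbounded F = ¬ (∃[ g ] ∀ f → f ∈ F → f ≤* g)

Splitting : 𝒫 (𝒫 ℕ) → Set
Splitting F =
  (∀ e → e ∈ F → Infinite e) ×
  (∀ b → Infinite b →
     ∃[ e ] e ∈ F × Infinite (b ∩ e) × Infinite (b ∩ ∁ e))

Is𝔟 Is𝔰 : Cardinal → Set
Is𝔟 = IsLeastSize Unbounded
Is𝔰 = IsLeastSize Splitting

IsSuccessor : Cardinal → Cardinal → Set₁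
IsSuccessor μ κ = μ <ᶜ κ × (∀ ν → μ <ᶜ ν → κ ≤ᶜ ν)

Isℵ : ℕ → Cardinal → Set₁
Isℵ zero    κ = Lift (lsuc 0ℓ) (Carrier κ ↔ ℕ)
Isℵ (suc n) κ = ∃[ μ ] Isℵ n μ × IsSuccessor μ κ

-- ℵ_ω is the supremum of the ℵ_n.
Isℵω : Cardinal → Set₁
Isℵω κ =
  (∀ n μ → Isℵ n μ → μ ≤ᶜ κ) ×
  (∀ ν → (∀ n μ → Isℵ n μ → μ ≤ᶜ ν) → κ ≤ᶜ ν)

-- For an ordinal α, ω ≤ α iff α is infinite.
ω≤ : (κ : Cardinal) → Carrier κ → Set
ω≤ κ α = ℕ ↣ ⟦ below κ α ⟧

-- u is a total function whose values at finite α are irrelevant.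
P : Cardinal → Set
P κ =
  Σ (Carrier κ → 𝒫 (Carrier κ)) λ u →
    (∀ α → ω≤ κ α →
       (∀ β → β ∈ u α → β ∈ below κ α) × (⟦ u α ⟧ ↔ ℕ)) ×
    (∀ (X : ℕ → 𝒫 (Carrier κ)) → (∀ n → ⟦ X n ⟧ ↔ Carrier κ) →
       ∃[ α ] ω≤ κ α × ∃^∞ (λ n → Nonempty (u α ∩ X n)))

AlmostDisjoint : 𝒫 (𝒫 ℕ) → Set
AlmostDisjoint 𝒜 =
  (∀ a → a ∈ 𝒜 → Infinite a) ×
  (∀ a b → a ∈ 𝒜 → b ∈ 𝒜 → a ≢ b → Finite (a ∩ b))

-- The ideal generated by 𝒜 together with the finite sets.
ℐ ℐ⁺ : 𝒫 (𝒫 ℕ) → 𝒫 ℕ → Set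
ℐ  𝒜 x = ∃[ as ] All (_∈ 𝒜) as × Finite (x ∖ ⋃ as)
ℐ⁺ 𝒜 x = ¬ ℐ 𝒜 x

WeaklyTight : 𝒫 (𝒫 ℕ) → Set
WeaklyTight 𝒜 =
  AlmostDisjoint 𝒜 ×
  (∀ (b : ℕ → 𝒫 ℕ) → (∀ n → ℐ⁺ 𝒜 (b n)) →
     ∃[ a ] a ∈ 𝒜 × ∃^∞ (λ n → Infinite (b n ∩ a)))

WeaklyTightOfSize𝔠 : Set
WeaklyTightOfSize𝔠 = ∃[ 𝒜 ] WeaklyTight 𝒜 × (⟦ 𝒜 ⟧ ↔ 𝒫 ℕ)

{-# OPTIONS --safe #-}
-- In each part 𝔰 ≤ 𝔟, so there is a splitting family (e_j) whose well-ordered index set has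
-- initial segments of size < 𝔟.  It may be taken (ω,ω)-splitting: if its size is < 𝔟, choosing
-- one point from each set of a sequence reduces the claim to splitting; otherwise combine it
-- with an unbounded family of interval partitions (unions of blocks selected by e_j), indexed
-- by pairs.
--
-- For a sequence of infinite sets, taking the first e_j that (ω,ω)-splits it and passing to
-- either half produces a perfect tree of nodes in 2^{<κ}.  Along a branch τ a diagonal
-- subsequence q_k satisfies, for every j in the domain of τ, q_k ⊆* e_j^{τ(j)} for almost
-- all k.  Since distinct branches clash, τ can be chosen below none of the fewer than 2^ω
-- nodes used before.  Every earlier set then either clashes with τ or is attached to a
-- restriction of τ, and the latter are fewer than 𝔟, so one function g dominates all the
-- requirements.  Applied to a sequence of parts of one positive set b, choosing points of
-- q_k beyond g(k) yields an infinite x ⊆ b almost disjoint from the earlier family.  Applied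
-- to such x_n ⊆ b_n, the union of the q_k ∖ g(k) is the next member: its pieces sit at their
-- own nodes, which converge to τ.  Recursion along a well-order of 2^ω treats all sequences.

module Submission where

open import Axiom.Extensionality.Propositional
  using (Extensionality; lower-extensionality; implicit-extensionality)
open import Data.Bool as Bool using (Bool; true; false; not; T)
open import Data.Bool.Properties using (T-irrelevant; T-∧; T-∨)
open import Data.Empty using (⊥; ⊥-elim)
open import Data.Fin using (toℕ)
open import Data.Fin.Properties using (toℕ-injective)
open import Data.List using (List; []; _∷_; map; lookup)
open import Data.List.Relation.Unary.All using (All; []; _∷_)
open import Data.List.Relation.Unary.Any as Any using (Any; here; there)
open import Data.List.Relation.Unary.Any.Properties using (lookup-index)
open import Data.Nat hiding (compare)
open import Data.Nat.Properties
open import Data.Product hiding (map)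
open import Data.Sum as Sum using (_⊎_; inj₁; inj₂)
open import Data.Unit using (⊤; tt)
open import Defs
open import Function using (_∘_; id)
open import Function.Bundles
  using (_↔_; _↣_; mk↔ₛ′; mk↣; module Inverse; module Injection; module Equivalence)
open import Function.Properties.Inverse using (↔⇒↣)
open import Induction.WellFounded as WF using (WellFounded; Acc; acc)
open import Level using (0ℓ; Lift; lift; lower) renaming (suc to lsuc)
open import Relation.Binary using (Trichotomous; tri<; tri≈; tri>)
open import Relation.Binary.PropositionalEquality
open import Relation.Binary.Structures using (IsStrictTotalOrder)
import Relation.Binary.Construct.On as On
open import Relation.Nullary using (¬_; Dec; yes; no; does)
open import Relation.Nullary.Decidable using (map′)

-- Predicates on ℕ, with "almost all" and "infinitely many".

Sub : Set₁
Sub = ℕ → Set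

Inf Fin : Sub → Set
Inf a = ∃^∞ a
Fin a = ∀^∞ (λ n → ¬ a n)

infix 4 _⊆*_
_⊆*_ : Sub → Sub → Set
a ⊆* b = ∀^∞ (λ n → a n → b n)

∀^∞-map : {Q R : ℕ → Set} → (∀ n → Q n → R n) → ∀^∞ Q → ∀^∞ R
∀^∞-map h (m , q) = m , λ n m≤n → h n (q n m≤n)

∀^∞-zip : {Q R S : ℕ → Set} → (∀ n → Q n → R n → S n) → ∀^∞ Q → ∀^∞ R → ∀^∞ S
∀^∞-zip h (m , q) (l , r) =
  m ⊔ l , λ n ml≤n → h n (q n (m⊔n≤o⇒m≤o m l ml≤n)) (r n (m⊔n≤o⇒n≤o m l ml≤n))

∃^∞-map : {Q R : ℕ → Set} → (∀ n → Q n → R n) → ∃^∞ Q → ∃^∞ R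
∃^∞-map h q m = let (n , m≤n , qn) = q m in n , m≤n , h n qn

∃^∞-∀^∞ : {Q R : ℕ → Set} → ∃^∞ Q → ∀^∞ R → ∃^∞ (λ n → Q n × R n)
∃^∞-∀^∞ q (l , r) m =
  let (n , ml≤n , qn) = q (m ⊔ l) in
  n , m⊔n≤o⇒m≤o m l ml≤n , qn , r n (m⊔n≤o⇒n≤o m l ml≤n)

∀^∞-< : {Q : ℕ → ℕ → Set} (K : ℕ) → (∀ k → k < K → ∀^∞ (Q k)) →
        ∀^∞ (λ n → ∀ k → k < K → Q k n)
∀^∞-< zero    h = 0 , λ _ _ _ ()
∀^∞-< {Q} (suc K) h =
  ∀^∞-zip join (h K (n<1+n K)) (∀^∞-< K (λ k k<K → h k (m<n⇒m<1+n k<K)))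
  where
  join : ∀ n → Q K n → (∀ k → k < K → Q k n) → ∀ k → k < suc K → Q k n
  join n q qs k k<1+K with m≤n⇒m<n∨m≡n (s≤s⁻¹ k<1+K)
  ... | inj₁ k<K  = qs k k<K
  ... | inj₂ refl = q

-- Eventual domination and index sets of size below 𝔟.

runmax : (ℕ → ℕ) → ℕ → ℕ
runmax f zero    = f 0
runmax f (suc n) = runmax f n ⊔ f (suc n)

≤runmax : ∀ f {i n} → i ≤ n → f i ≤ runmax f n
≤runmax f {i} {zero} z≤n = ≤-refl
≤runmax f {i} {suc n} i≤1+n with m≤n⇒m<n∨m≡n i≤1+n
... | inj₁ i<1+n = ≤-trans (≤runmax f (s≤s⁻¹ i<1+n)) (m≤m⊔n _ _)
... | inj₂ refl  = m≤n⊔m (runmax f n) (f (suc n))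

runmax-mono : ∀ f {m n} → m ≤ n → runmax f m ≤ runmax f n
runmax-mono f {m} {zero} z≤n = ≤-refl
runmax-mono f {m} {suc n} m≤1+n with m≤n⇒m<n∨m≡n m≤1+n
... | inj₁ m<1+n = ≤-trans (runmax-mono f (s≤s⁻¹ m<1+n)) (m≤m⊔n _ _)
... | inj₂ refl  = ≤-refl

-- Small D: families in ℕ → ℕ indexed by D are bounded, i.e. D plays the role of a set of size < 𝔟.
Small : {I : Set} → (I → Set) → Set
Small {I} D = (f : I → ℕ → ℕ) → ∃[ g ] ∀ i → D i → f i ≤* g

countable-bound : (g : ℕ → ℕ → ℕ) → ∃[ h ] ∀ n → g n ≤* h
countable-bound g = (λ m → runmax (λ i → g i m) m) , λ n → n , λ m n≤m → ≤runmax (λ i → g i m) n≤m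

≤*-trans : ∀ {f g h} → f ≤* g → g ≤* h → f ≤* h
≤*-trans = ∀^∞-zip (λ _ → ≤-trans)

Small-⊆ : {I : Set} {D E : I → Set} → (∀ i → D i → E i) → Small E → Small D
Small-⊆ D⊆E small f = let (g , b) = small f in g , λ i d → b i (D⊆E i d)

-- The bounds for the separate `D n` are countably many and so have a common bound: 𝔟 has
-- uncountable cofinality.
Small-⋃ : {I : Set} {D : ℕ → I → Set} → (∀ n → Small (D n)) → Small (λ i → ∃[ n ] D n i)
Small-⋃ small f =
  let (h , b) = countable-bound (λ n → proj₁ (small n f)) in
  h , λ { i (n , d) → ≤*-trans (proj₂ (small n f) i d) (b n) }

Small-∪ : {I : Set} {D E : I → Set} → Small D → Small E → Small (λ i → D i ⊎ E i)
Small-∪ sD sE f =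
  let (g , b) = sD f ; (h , c) = sE f in
  (λ n → g n ⊔ h n) , λ
    { i (inj₁ d) → ∀^∞-map (λ n p → ≤-trans p (m≤m⊔n _ _)) (b i d)
    ; i (inj₂ d) → ∀^∞-map (λ n p → ≤-trans p (m≤n⊔m (g n) _)) (c i d) }

Small-≡ : {I : Set} (i : I) → Small (_≡ i)
Small-≡ i f = f i , λ { _ refl → 0 , λ _ _ → ≤-refl }

-- Well-orders, their pullbacks and lexicographic products.

record WellOrder (W : Set) : Set₁ where
  infix 4 _≺_
  field
    _≺_     : W → W → Set
    ≺-trans : ∀ {x y z} → x ≺ y → y ≺ z → x ≺ z
    compare : ∀ x y → x ≺ y ⊎ x ≡ y ⊎ y ≺ x
    wf      : WellFounded _≺_

  infix 4 _≼_
  _≼_ : W → W → Set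
  x ≼ y = x ≺ y ⊎ x ≡ y

pullback : {A W : Set} (O : WellOrder W) (f : A → W) → (∀ {x y} → f x ≡ f y → x ≡ y) → WellOrder A
pullback {A} O f f-inj = record
  { _≺_ = λ x y → f x ≺ f y
  ; ≺-trans = ≺-trans
  ; compare = λ x y → cmp (compare (f x) (f y))
  ; wf = λ x → go (wf (f x)) }
  where
  open WellOrder O
  cmp : ∀ {x y} → f x ≺ f y ⊎ f x ≡ f y ⊎ f y ≺ f x → f x ≺ f y ⊎ x ≡ y ⊎ f y ≺ f x
  cmp (inj₁ p) = inj₁ p
  cmp (inj₂ (inj₁ p)) = inj₂ (inj₁ (f-inj p))
  cmp (inj₂ (inj₂ p)) = inj₂ (inj₂ p)
  go : ∀ {x} → Acc _≺_ (f x) → Acc (λ x y → f x ≺ f y) x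
  go (acc rs) = acc λ p → go (rs p)

lexProduct : {A B : Set} → WellOrder A → WellOrder B → WellOrder (A × B)
lexProduct {A} {B} O P = record
  { _≺_ = _≺_ ; ≺-trans = tr ; compare = cmp ; wf = λ { (a , b) → go (O.wf a) (P.wf b) } }
  where
  module O = WellOrder O
  module P = WellOrder P
  _≺_ : A × B → A × B → Set
  (a , b) ≺ (c , d) = a O.≺ c ⊎ (a ≡ c × b P.≺ d)
  tr : ∀ {x y z} → x ≺ y → y ≺ z → x ≺ z
  tr (inj₁ p) (inj₁ q) = inj₁ (O.≺-trans p q)
  tr (inj₁ p) (inj₂ (refl , _)) = inj₁ p
  tr (inj₂ (refl , _)) (inj₁ q) = inj₁ q
  tr (inj₂ (refl , p)) (inj₂ (refl , q)) = inj₂ (refl , P.≺-trans p q)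
  cmp : ∀ x y → x ≺ y ⊎ x ≡ y ⊎ y ≺ x
  cmp (a , b) (c , d) with O.compare a c
  ... | inj₁ p = inj₁ (inj₁ p)
  ... | inj₂ (inj₂ p) = inj₂ (inj₂ (inj₁ p))
  ... | inj₂ (inj₁ refl) with P.compare b d
  ...   | inj₁ p = inj₁ (inj₂ (refl , p))
  ...   | inj₂ (inj₁ refl) = inj₂ (inj₁ refl)
  ...   | inj₂ (inj₂ p) = inj₂ (inj₂ (inj₂ (refl , p)))
  go : ∀ {a b} → Acc O._≺_ a → Acc P._≺_ b → Acc _≺_ (a , b)
  go {a} (acc rs) = inner
    where
    inner : ∀ {b} → Acc P._≺_ b → Acc _≺_ (a , b)
    inner (acc ss) = acc λ { {c , d} (inj₁ p) → go (rs p) (P.wf d)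
                           ; (inj₂ (refl , p)) → inner (ss p) }

-- Cantor's enumeration of ℕ × ℕ along antidiagonals.

next : ℕ × ℕ → ℕ × ℕ
next (zero , y)  = suc y , 0
next (suc x , y) = x , suc y

unpair : ℕ → ℕ × ℕ
unpair zero    = 0 , 0
unpair (suc n) = next (unpair n)

unpair-sum : ∀ n → proj₁ (unpair n) + proj₂ (unpair n) ≤ n
unpair-sum zero = z≤n
unpair-sum (suc n) with unpair n | unpair-sum n
... | zero , y  | le = s≤s (≤-trans (≤-reflexive (+-identityʳ y)) le)
... | suc x , y | le = ≤-trans (≤-trans (≤-reflexive (+-suc x y)) le) (n≤1+n n)

unpair-onto : ∀ x y → ∃[ n ] unpair n ≡ (x , y)
unpair-onto x y = diagonal (x + y) x y refl
  where
  diagonal : ∀ s x y → x + y ≡ s → ∃[ n ] unpair n ≡ (x , y)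
  slide : ∀ s y x → x + y ≡ s → ∃[ n ] unpair n ≡ (x , y)
  diagonal s x y = slide s y x
  slide zero    zero x eq = 0 , sym (cong (_, 0) (trans (sym (+-identityʳ x)) eq))
  slide (suc s) zero zero ()
  slide (suc s) zero (suc x) eq =
    let (n , p) = slide s x zero (suc-injective (trans (sym (+-identityʳ (suc x))) eq)) in
    suc n , cong next p
  slide s (suc y) x eq =
    let (n , p) = slide s y (suc x) (trans (sym (+-suc x y)) eq) in
    suc n , cong next p

pair : ℕ → ℕ → ℕ
pair x y = proj₁ (unpair-onto x y)

unpair-pair : ∀ x y → unpair (pair x y) ≡ (x , y)
unpair-pair x y = proj₂ (unpair-onto x y)

y≤pair : ∀ x y → y ≤ pair x y
y≤pair x y = ≤-trans (m≤n+m y x)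
  (subst (λ p → proj₁ p + proj₂ p ≤ pair x y) (unpair-pair x y) (unpair-sum (pair x y)))

-- Sides of a splitting family, and selectors.

side : {J : Set} → (J → Sub) → J → Bool → Sub
side e j true  n = e j n
side e j false n = ¬ e j n

side-clash : {J : Set} (e : J → Sub) (j : J) (v w : Bool) {n : ℕ} →
             v ≢ w → side e j v n → ¬ side e j w n
side-clash e j true  true  v≢w _ _ = v≢w refl
side-clash e j true  false _ s t = t s
side-clash e j false true  _ s t = s t
side-clash e j false false v≢w _ _ = v≢w refl

Splits : {J : Set} → (J → Sub) → Sub → J → Set
Splits e x j = ∀ v → Inf (λ m → x m × side e j v m)

-- (ω,ω)-splitting of a sequence of sets
Splitsω : {J : Set} → (J → Sub) → (ℕ → Sub) → J → Set
Splitsω e p j = ∀ v → ∃^∞ (λ n → Inf (λ m → p n m × side e j v m))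

Escapes : (ℕ → Sub) → (ℕ → ℕ) → Sub → Set
Escapes q g z = ∀^∞ (λ k → ∀ m → g k ≤ m → q k m → ¬ z m)

not≢ : ∀ v → v ≢ not v
not≢ true ()
not≢ false ()

-- A selector with one point of each q k beyond g k.
thin : (q : ℕ → Sub) → (∀ k → Inf (q k)) → (g : ℕ → ℕ) →
       Σ Sub λ x → Inf x × (∀ m → x m → ∃[ k ] q k m) ×
                   (∀ z → Escapes q g z → Fin (λ m → x m × z m))
thin q q-inf g = (λ m → ∃[ k ] m ≡ pt k) , x-inf , (λ { m (k , refl) → k , pt-in k }) , x-fin
  where
  pt : ℕ → ℕ
  -- Lying beyond `k` makes the selector infinite; lying beyond `g k` lets `Escapes` apply.
  pt k = proj₁ (q-inf k (g k ⊔ k))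
  pt-in : ∀ k → q k (pt k)
  pt-in k = proj₂ (proj₂ (q-inf k (g k ⊔ k)))
  pt-≥ : ∀ k → g k ⊔ k ≤ pt k
  pt-≥ k = proj₁ (proj₂ (q-inf k (g k ⊔ k)))
  x-inf : Inf (λ m → ∃[ k ] m ≡ pt k)
  x-inf k = pt k , m⊔n≤o⇒n≤o (g k) k (pt-≥ k) , k , refl
  x-fin : ∀ z → Escapes q g z → Fin (λ m → (∃[ k ] m ≡ pt k) × z m)
  x-fin z (K , esc) = suc (runmax pt K) , λ { .(pt k) lt ((k , refl) , zm) → beyond k lt zm }
    where
    beyond : ∀ k → suc (runmax pt K) ≤ pt k → ¬ z (pt k)
    beyond k lt with ≤-total k K
    ... | inj₁ k≤K = λ _ → <-irrefl refl (≤-trans lt (≤runmax pt k≤K))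
    ... | inj₂ K≤k = esc k K≤k (pt k) (m⊔n≤o⇒m≤o (g k) k (pt-≥ k)) (pt-in k)

-- Classical reasoning; splitting against (ω,ω)-splitting.

module WithEM (em : ∀ {P : Set} → Dec P) where

  by-contradiction : {P : Set} → ¬ ¬ P → P
  by-contradiction {P} ¬¬p with em {P}
  ... | yes p = p
  ... | no ¬p = ⊥-elim (¬¬p ¬p)

  ¬∀⇒∃¬ : {A : Set} {Q : A → Set} → ¬ (∀ x → Q x) → ∃[ x ] ¬ Q x
  ¬∀⇒∃¬ h = by-contradiction λ ¬∃ → h λ x → by-contradiction λ ¬q → ¬∃ (x , ¬q)

  ¬∃^∞⇒∀^∞¬ : {Q : ℕ → Set} → ¬ ∃^∞ Q → ∀^∞ (λ n → ¬ Q n)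
  ¬∃^∞⇒∀^∞¬ h = let (m , ¬q) = ¬∀⇒∃¬ h in m , λ n m≤n q → ¬q (n , m≤n , q)

  ¬∀^∞¬⇒∃^∞ : {Q : ℕ → Set} → ¬ ∀^∞ (λ n → ¬ Q n) → ∃^∞ Q
  ¬∀^∞¬⇒∃^∞ h = by-contradiction λ ¬q → h (¬∃^∞⇒∀^∞¬ ¬q)

  least : {W : Set} (O : WellOrder W) (let open WellOrder O) (Q : W → Set) →
          ∃ Q → ∃[ x ] Q x × (∀ y → y ≺ x → ¬ Q y)
  least O Q (x , q) = go (wf x) q
    where
    open WellOrder O
    go : ∀ {x} → Acc _≺_ x → Q x → ∃[ x ] Q x × (∀ y → y ≺ x → ¬ Q y)
    go {x} (acc rs) q with em {∃[ y ] y ≺ x × Q y}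
    ... | yes (y , y≺x , qy) = go (rs y≺x) qy
    ... | no none = x , q , λ y y≺x qy → none (y , y≺x , qy)

  -- The default 0 makes `bounds` total, so that it can enter a `Small` family even where finiteness
  -- fails.
  bound : Sub → ℕ
  bound a with em {Fin a}
  ... | yes (m , _) = m
  ... | no _        = 0

  beyond-bound : ∀ {a} → Fin a → ∀ m → bound a ≤ m → ¬ a m
  beyond-bound {a} fin with em {Fin a}
  ... | yes (_ , h) = h
  ... | no ¬fin     = ⊥-elim (¬fin fin)

  bounds : (ℕ → Sub) → Sub → ℕ → ℕ
  bounds q z k = bound (λ m → q k m × z m)

  escapes : (q : ℕ → Sub) (z : Sub) {g : ℕ → ℕ} →
            ∀^∞ (λ k → Fin (λ m → q k m × z m)) → bounds q z ≤* g → Escapes q g z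
  escapes q z = ∀^∞-zip λ k fin b≤g m g≤m qm zm →
    beyond-bound fin m (≤-trans b≤g g≤m) (qm , zm)

  module _ {J : Set} (e : J → Sub) where

    other-side : ∀ j v {n} → ¬ side e j (not v) n → side e j v n
    other-side j true  s = by-contradiction s
    other-side j false s = s

    Decided : (ℕ → Sub) → J → Bool → Set
    Decided p j v = ∀^∞ (λ n → p n ⊆* side e j v)

    -- For one side `v`, almost all `p n` meet that side in a finite set only, hence are almost
    -- contained in the opposite one.
    unsplit⇒decided : ∀ p j → ¬ Splitsω e p j → ∃[ v ] Decided p j v
    unsplit⇒decided p j ¬s =
      let (v , ¬inf) = ¬∀⇒∃¬ ¬s in
      not v , ∀^∞-map (λ n ¬i → ∀^∞-map (λ m h pm → flipped v λ s → h (pm , s)) (¬∃^∞⇒∀^∞¬ ¬i))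
                      (¬∃^∞⇒∀^∞¬ ¬inf)
      where
      flipped : ∀ v {m} → ¬ side e j v m → side e j (not v) m
      flipped true  s = s
      flipped false s = by-contradiction s

    decided-fin : ∀ p j v → Decided p j v →
                  ∀^∞ (λ n → Fin (λ m → p n m × side e j (not v) m))
    decided-fin p j v = ∀^∞-map λ n → ∀^∞-map λ m h (pm , s) →
      side-clash e j v (not v) (not≢ v) (h pm) s

    -- If no `j` works, every `j` decides the sequence, and one `g` dominates the resulting bounds.
    -- A selector beyond `g` is then almost on one side of every `e j`, so no `e j` splits it.
    small-splitsω : Small {J} (λ _ → ⊤) →
                    (∀ x → Inf x → ∃ (Splits e x)) →
                    ∀ p → (∀ n → Inf (p n)) → ∃ (Splitsω e p)
    small-splitsω small splitting p p-inf = by-contradiction λ none →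
      let dec = λ j → unsplit⇒decided p j λ s → none (j , s)
          val = λ j → proj₁ (dec j)
          z   = λ j → side e j (not (val j))
          (g , b) = small (λ j → bounds p (z j))
          (x , x-inf , _ , x-fin) = thin p p-inf g
          (i , s) = splitting x x-inf
          (N , h) = x-fin (z i) (escapes p (z i) (decided-fin p i (val i) (proj₂ (dec i))) (b i tt))
          (m , N≤m , xz) = s (not (val i)) N
      in h m N≤m xz

-- Small sets of pairs.

Small-× : {I : Set} {D E : I → Set} → Small D → Small E →
          Small (λ ((a , b) : I × I) → D a × E b)
Small-× sD sE f =
  let rows = λ a → sE (λ b → f (a , b))
      (h , c) = sD (λ a → proj₁ (rows a)) in
  h , λ { (a , b) (d , d′) → ≤*-trans (proj₂ (rows a) b d′) (c a d) }

Small-≼ : {I : Set} (O : WellOrder I) (let open WellOrder O) →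
          (∀ i → Small (_≺ i)) → ∀ i → Small (_≼ i)
Small-≼ O seg i = Small-∪ (seg i) (Small-≡ i)

-- Gödel's order on pairs compares maxima first, so that proper initial segments stay small.
module Gödel {I : Set} (O : WellOrder I) where
  open WellOrder O

  max : ∀ a b → ∃[ c ] a ≼ c × b ≼ c
  max a b with compare a b
  ... | inj₁ a≺b        = b , inj₁ a≺b , inj₂ refl
  ... | inj₂ (inj₁ a≡b) = b , inj₂ a≡b , inj₂ refl
  ... | inj₂ (inj₂ b≺a) = a , inj₂ refl , inj₁ b≺a

  key : I × I → I × I × I
  key (a , b) = proj₁ (max a b) , a , b

  order : WellOrder (I × I)
  order = pullback (lexProduct O (lexProduct O O)) key (cong proj₂)

  ≼-trans : ∀ {a b c} → a ≼ b → b ≼ c → a ≼ c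
  ≼-trans (inj₁ p) (inj₁ q) = inj₁ (≺-trans p q)
  ≼-trans p (inj₂ refl) = p
  ≼-trans (inj₂ refl) q = q

  -- Both coordinates of an earlier pair are at most the maximum `m`, so the segment lies in the
  -- square of a small set.
  segment : (∀ i → Small (_≺ i)) → ∀ z → Small (λ y → WellOrder._≺_ order y z)
  segment seg (c , d) =
    Small-⊆ (λ { (a , b) lt → let (_ , a≼ , b≼) = max a b in
                 ≼-trans a≼ (key-≼ lt) , ≼-trans b≼ (key-≼ lt) })
            (Small-× (Small-≼ O seg m) (Small-≼ O seg m))
    where
    m = proj₁ (max c d)
    key-≼ : ∀ {a b} → WellOrder._≺_ order (a , b) (c , d) → proj₁ (max a b) ≼ m
    key-≼ (inj₁ p)       = inj₁ p
    key-≼ (inj₂ (p , _)) = inj₂ p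

-- Interval partitions; (ω,ω)-splitting from an unbounded family.

-- The interval partition [points f n , points f (1 + n)) associated with f.
points : (ℕ → ℕ) → ℕ → ℕ
points f zero    = 0
points f (suc n) = suc (points f n ⊔ runmax f (points f n))

InBlock : (ℕ → ℕ) → ℕ → ℕ → Set
InBlock f n m = points f n ≤ m × m < points f (suc n)

points-step : ∀ f n → points f n < points f (suc n)
points-step f n = s≤s (m≤m⊔n _ _)

points-mono : ∀ f {m n} → m ≤ n → points f m ≤ points f n
points-mono f {n = zero} z≤n = ≤-refl
points-mono f {m} {suc n} m≤1+n with m≤n⇒m<n∨m≡n m≤1+n
... | inj₁ m<1+n = ≤-trans (points-mono f (s≤s⁻¹ m<1+n)) (<⇒≤ (points-step f n))
... | inj₂ refl  = ≤-refl

n≤points : ∀ f n → n ≤ points f n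
n≤points f zero    = z≤n
n≤points f (suc n) = ≤-trans (s≤s (n≤points f n)) (points-step f n)

f<points : ∀ f {i} n → i ≤ points f n → f i < points f (suc n)
f<points f n i≤ = s≤s (≤-trans (≤runmax f i≤) (m≤n⊔m (points f n) _))

block : ∀ f m → ∃[ n ] InBlock f n m
block f m = go m (n≤points f m)
  where
  go : ∀ k → m ≤ points f k → ∃[ n ] InBlock f n m
  go zero    m≤ = 0 , z≤n , ≤-<-trans m≤ (points-step f 0)
  go (suc k) m≤ with points f k ≤? m
  ... | no  pk≰m = go k (<⇒≤ (≰⇒> pk≰m))
  ... | yes pk≤m with m≤n⇒m<n∨m≡n m≤
  ...   | inj₁ m<  = k , pk≤m , m<
  ...   | inj₂ m≡p = suc k , ≤-reflexive (sym m≡p) , subst (_< points f (2 + k)) (sym m≡p) (points-step f (suc k))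

block-unique : ∀ f {m n k} → InBlock f n m → InBlock f k m → n ≡ k
block-unique f {m} {n} {k} (n≤ , <n) (k≤ , <k) with <-cmp n k
... | tri< n<k _ _ = ⊥-elim (<-irrefl refl (<-≤-trans <n (≤-trans (points-mono f n<k) k≤)))
... | tri≈ _ n≡k _ = n≡k
... | tri> _ _ k<n = ⊥-elim (<-irrefl refl (<-≤-trans <k (≤-trans (points-mono f k<n) n≤)))

module BlockSplitting (em : ∀ {P : Set} → Dec P) {I : Set} (e : I → Sub)
  (splitting : ∀ x → Inf x → ∃ (Splits e x))
  (f : I → ℕ → ℕ) (unbounded : ∀ g → ∃[ i ] ¬ (f i ≤* g)) where
  open WithEM em

  blocks : I × I → Sub
  blocks (a , b) m = ∃[ n ] e b n × InBlock (f a) n m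

  in-side : ∀ a b v {n m} → InBlock (f a) n m → side e b v n → side blocks (a , b) v m
  in-side a b true  blk s = _ , s , blk
  in-side a b false blk s (k , ek , blk′) = s (subst (e b) (block-unique (f a) blk′ blk) ek)

  module _ (p : ℕ → Sub) (p-inf : ∀ n → Inf (p n)) where

    w : ℕ → ℕ → ℕ
    w m j = proj₁ (p-inf j m)

    -- Chosen so that each `p j` with `j ≤ m` has a point, namely `w m j`, at or above `m` and below
    -- `h m`.
    h : ℕ → ℕ
    h n = suc (runmax (λ m → runmax (w m) m) n)

    h-mono : ∀ {m n} → m ≤ n → h m ≤ h n
    h-mono m≤n = s≤s (runmax-mono _ m≤n)

    w<h : ∀ {m j} → j ≤ m → w m j < h m
    w<h {m} j≤m = s≤s (≤-trans (≤runmax (w m) j≤m) (≤runmax (λ m → runmax (w m) m) {m} ≤-refl))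

    Hit : I → ℕ → Set
    Hit a n = ∀ j → j ≤ n → ∃[ m ] p j m × InBlock (f a) n m

    -- Some `f a` exceeds `h ∘ h` at infinitely many `i`. Let such an `i` lie in block `n`. If `h i`
    -- does not pass the end of this block, the block is a hit. Otherwise the next block starts at
    -- or below `h i`, and since `f a i` exceeds `h (h i)`, it reaches beyond `h` of its own left
    -- end.
    hits : ∃[ a ] ∃^∞ (Hit a)
    hits = a , hit
      where
      a = proj₁ (unbounded (λ i → h (h i)))
      big : ∃^∞ (λ i → ¬ (f a i ≤ h (h i)))
      big = ¬∀^∞¬⇒∃^∞ λ fin → proj₂ (unbounded (λ i → h (h i))) (∀^∞-map (λ n → by-contradiction) fin)
      t = points (f a)
      meet : ∀ n m → t n ≤ m → h m ≤ t (suc n) → Hit a n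
      meet n m tn≤m hm≤ j j≤n =
        let j≤m = ≤-trans j≤n (≤-trans (n≤points (f a) n) tn≤m)
            (_ , m≤w , pw) = p-inf j m in
        w m j , pw , ≤-trans tn≤m m≤w , <-≤-trans (w<h j≤m) hm≤
      hit : ∃^∞ (Hit a)
      hit N with big (t N)
      ... | i , tN≤i , fi≰ with block (f a) i
      ...   | n , tn≤i , i<t with ≤-total (h i) (t (suc n))
      ...     | inj₁ hi≤ = n , N≤n , meet n i tn≤i hi≤
        where
        N≤n : N ≤ n
        N≤n = ≮⇒≥ λ n<N → <-irrefl refl (<-≤-trans i<t (≤-trans (points-mono (f a) n<N) tN≤i))
      ...     | inj₂ ≤hi = suc n , N≤1+n ,
                  meet (suc n) (t (suc n)) ≤-refl
                    (≤-trans (h-mono ≤hi) (<⇒≤ (<-trans (≰⇒> fi≰) (f<points (f a) (suc n) (<⇒≤ i<t)))))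
        where
        N≤1+n : N ≤ suc n
        N≤1+n = ≮⇒≥ λ n<N → <-irrefl refl (<-≤-trans i<t (≤-trans (points-mono (f a) (<⇒≤ n<N)) tN≤i))

    -- Some `e b` splits the infinite set of numbers of hitting blocks. Each side of
    -- `blocks (a , b)` then contains infinitely many whole blocks that meet a given `p j`.
    blocks-split : ∃ (Splitsω blocks p)
    blocks-split =
      let (a , hit) = hits
          (b , s)   = splitting (Hit a) hit in
      (a , b) , λ v j → j , ≤-refl , λ M →
        let (n , jM≤n , hn , sn) = s v (j ⊔ M)
            (m , pm , blk) = hn j (m⊔n≤o⇒m≤o j M jM≤n) in
        m , ≤-trans (m⊔n≤o⇒n≤o j M jM≤n) (≤-trans (n≤points (f a) n) (proj₁ blk)) ,
        pm , in-side a b v blk sn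

-- Refinements of sequences of sets.

Refines : (ℕ → Sub) → (ℕ → Sub) → Set
Refines q p = ∀ k → ∃[ n ] k ≤ n × (∀ m → q k m → p n m)

Refines-refl : ∀ {p} → Refines p p
Refines-refl k = k , ≤-refl , λ _ → id

Refines-trans : ∀ {p q r} → Refines r q → Refines q p → Refines r p
Refines-trans rq qp k =
  let (n , k≤n , r⊆q) = rq k
      (l , n≤l , q⊆p) = qp n in
  l , ≤-trans k≤n n≤l , λ m → q⊆p m ∘ r⊆q m

-- The clause `k ≤ n` of `Refines` places late members of `q` inside late members of `p`.
∀^∞-refine : ∀ {p q} (z : Sub) → Refines q p → ∀^∞ (λ n → p n ⊆* z) → ∀^∞ (λ n → q n ⊆* z)
∀^∞-refine z r (N , h) = N , λ k N≤k →
  let (n , k≤n , q⊆p) = r k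
      (M , t) = h n (≤-trans N≤k k≤n) in
  M , λ m M≤m → t m M≤m ∘ q⊆p m

-- The tree: restrictions, clashes and branches.

-- A node of the tree 2^{<κ}: only values at elements of Dom matter.
record Node {J : Set} (O : WellOrder J) : Set₁ where
  open WellOrder O
  field
    Dom   : J → Set
    lower : ∀ {i j} → i ≺ j → Dom j → Dom i
    small : Small Dom
    val   : J → Bool

module Tree (em : ∀ {P : Set} → Dec P) (ext : Extensionality 0ℓ 0ℓ)
  {J : Set} (O : WellOrder J) (e : J → Sub) (seg : ∀ i → Small (λ j → WellOrder._≺_ O j i))
  (splitting : ∀ p → (∀ n → Inf (p n)) → ∃ (Splitsω e p)) where
  open WithEM em
  open WellOrder O
  open Node

  infix 4 _⊑_
  _⊑_ : Node O → Node O → Set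
  τ ⊑ σ = ∀ j → Dom τ j → Dom σ j × val τ j ≡ val σ j

  Clash : Node O → Node O → Set
  Clash τ σ = ∃[ j ] Dom τ j × Dom σ j × val τ j ≢ val σ j

  IsRestriction : Node O → Node O → J → Set
  IsRestriction σ τ i =
    (∀ j → Dom σ j → j ≺ i × val σ j ≡ val τ j) × (∀ j → j ≺ i → Dom σ j)

  restriction-⊑ : ∀ {σ σ′ τ i} → IsRestriction σ τ i → IsRestriction σ′ τ i → σ ⊑ σ′
  restriction-⊑ (r , _) (r′ , d′) j d =
    let (j≺i , eq) = r j d ; d″ = d′ j j≺i in d″ , trans eq (sym (proj₂ (r′ j d″)))

  -- Domains are initial segments, so without a clash the first `i` in `Dom τ` outside `Dom σ` is
  -- exactly the length of `σ`.
  ⋢⇒clash-or-restriction : ∀ τ σ → ¬ (τ ⊑ σ) → Clash τ σ ⊎ ∃[ i ] Dom τ i × IsRestriction σ τ i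
  ⋢⇒clash-or-restriction τ σ τ⋢σ with em {Clash τ σ}
  ... | yes c = inj₁ c
  ... | no ¬c = inj₂ (i , τi , restricts , λ j j≺i → by-contradiction λ ¬σj → min j j≺i (lower τ j≺i τi , ¬σj))
    where
    agree : ∀ j → Dom τ j → Dom σ j → val τ j ≡ val σ j
    agree j d d′ = by-contradiction λ neq → ¬c (j , d , d′ , neq)
    first = least O (λ j → Dom τ j × ¬ Dom σ j) (by-contradiction λ none →
      τ⋢σ λ j d → let d′ = by-contradiction λ ¬d′ → none (j , d , ¬d′) in d′ , agree j d d′)
    i   = proj₁ first
    τi  = proj₁ (proj₁ (proj₂ first))
    ¬σi = proj₂ (proj₁ (proj₂ first))
    min = proj₂ (proj₂ first)
    restricts : ∀ j → Dom σ j → j ≺ i × val σ j ≡ val τ j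
    restricts j d with compare j i
    ... | inj₁ j≺i         = j≺i , sym (agree j (lower τ j≺i τi) d)
    ... | inj₂ (inj₁ refl) = ⊥-elim (¬σi d)
    ... | inj₂ (inj₂ i≺j)  = ⊥-elim (¬σi (lower σ i≺j d))

  Seq : Set₁
  Seq = Σ (ℕ → Sub) λ p → ∀ n → Inf (p n)

  -- Leastness matters: every smaller `j` fails to split the sequence and is therefore decided, so a
  -- branch has a meaningful value at each `j` up to the cut.
  splitter : (p : Seq) → ∃[ i ] Splitsω e (proj₁ p) i × (∀ j → j ≺ i → ¬ Splitsω e (proj₁ p) j)
  splitter (p , p-inf) = least O (Splitsω e p) (splitting p p-inf)

  child : Seq → Bool → Seq
  child P@(p , _) v = (λ k m → p (index k) m × side e i v m) , λ k → proj₂ (proj₂ (s v k))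
    where
    i = proj₁ (splitter P)
    s = proj₁ (proj₂ (splitter P))
    index : ℕ → ℕ
    index k = proj₁ (s v k)

  child-refines : ∀ p v → Refines (proj₁ (child p v)) (proj₁ p)
  child-refines p v k =
    let (n , k≤n , _) = proj₁ (proj₂ (splitter p)) v k in n , k≤n , λ m → proj₁

  decided-unique : ∀ (p : Seq) j v w → Decided e (proj₁ p) j v → Decided e (proj₁ p) j w → v ≡ w
  decided-unique (p , p-inf) j v w dv dw = by-contradiction λ v≢w →
    let (N , h) = ∀^∞-zip (λ n a b → a , b) dv dw
        (a , b) = h N ≤-refl
        (m , _ , pm , st) = ∃^∞-∀^∞ (p-inf N) (∀^∞-zip (λ m x y pm → x pm , y pm) a b) 0
    in side-clash e j v w v≢w (proj₁ (st pm)) (proj₂ (st pm))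

  module Branches (p : Seq) where

    stage : (ℕ → Bool) → ℕ → Seq
    stage f zero    = p
    stage f (suc n) = child (stage f n) (f n)

    cut : (ℕ → Bool) → ℕ → J
    cut f n = proj₁ (splitter (stage f n))

    stage-refines : ∀ f {m n} → m ≤ n → Refines (proj₁ (stage f n)) (proj₁ (stage f m))
    stage-refines f {n = zero} z≤n = Refines-refl
    stage-refines f {m} {suc n} m≤1+n with m≤n⇒m<n∨m≡n m≤1+n
    ... | inj₁ m<1+n = Refines-trans (child-refines (stage f n) (f n)) (stage-refines f (s≤s⁻¹ m<1+n))
    ... | inj₂ refl  = Refines-refl

    decides-cut : ∀ f n → Decided e (proj₁ (stage f (suc n))) (cut f n) (f n)
    decides-cut f n = 0 , λ _ _ → 0 , λ _ _ → proj₂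

    decides : ∀ f n j → j ≼ cut f n → ∃[ v ] Decided e (proj₁ (stage f (suc n))) j v
    decides f n j (inj₂ refl) = f n , decides-cut f n
    decides f n j (inj₁ j≺) =
      let (v , d) = unsplit⇒decided e _ j (proj₂ (proj₂ (splitter (stage f n))) j j≺) in
      v , ∀^∞-refine (side e j v) (child-refines (stage f n) (f n)) d

    decided-coherent : ∀ f j m n v w → Decided e (proj₁ (stage f m)) j v →
                       Decided e (proj₁ (stage f n)) j w → v ≡ w
    decided-coherent f j m n v w dv dw with ≤-total m n
    ... | inj₁ m≤n = decided-unique (stage f n) j v w (∀^∞-refine (side e j v) (stage-refines f m≤n) dv) dw
    ... | inj₂ n≤m = decided-unique (stage f m) j v w dv (∀^∞-refine (side e j w) (stage-refines f n≤m) dw)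

    -- `false` also serves as default where no stage decides `j`; by `decides` this happens only
    -- outside the domain of the branch.
    value : ∀ f j → Bool
    value f j with em {∃[ n ] Decided e (proj₁ (stage f n)) j true}
    ... | yes _ = true
    ... | no _  = false

    value-decided : ∀ f j n v → Decided e (proj₁ (stage f n)) j v → value f j ≡ v
    value-decided f j n v d with em {∃[ n ] Decided e (proj₁ (stage f n)) j true}
    ... | yes (l , d′) = decided-coherent f j l n true v d′ d
    value-decided f j n true  d | no none = ⊥-elim (none (n , d))
    value-decided f j n false d | no none = refl

    branch : (ℕ → Bool) → Node O
    branch f = record
      { Dom   = λ j → ∃[ n ] j ≼ cut f n
      ; lower = λ { i≺j (n , inj₁ j≺) → n , inj₁ (≺-trans i≺j j≺) ; i≺j (n , inj₂ refl) → n , inj₁ i≺j }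
      ; small = Small-⋃ (λ n → Small-≼ O seg (cut f n))
      ; val   = value f }

    diagonal : (ℕ → Bool) → ℕ → Sub
    diagonal f k = proj₁ (stage f k) k

    diagonal-inf : ∀ f k → Inf (diagonal f k)
    diagonal-inf f k = proj₂ (stage f k) k

    diagonal-refines : ∀ f → Refines (diagonal f) (proj₁ p)
    diagonal-refines f k = stage-refines f (z≤n {k}) k

    diagonal-at : ∀ f j → Dom (branch f) j → Decided e (diagonal f) j (val (branch f) j)
    diagonal-at f j (n , j≼) with decides f n j j≼
    -- From index `suc n` on, diagonal sets lie in members of stage `suc n`, which decides `j`;
    -- indices from `N` on reach the members already decided there.
    ... | v , d@(N , h) rewrite value-decided f j (suc n) v d = suc n ⊔ N , λ k le →
      let (l , k≤l , sub) = stage-refines f (m⊔n≤o⇒m≤o (suc n) N le) k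
          (M , t) = h l (≤-trans (m⊔n≤o⇒n≤o (suc n) N le) k≤l) in
      M , λ m M≤m → t m M≤m ∘ sub m

    -- By induction both run through the same stages. Equal stages have equal cuts, and there the
    -- branches take the bits of `f` and `f′` as values, so different bits would clash.
    branches-clash : ∀ f f′ → ¬ Clash (branch f) (branch f′) → f ≡ f′
    branches-clash f f′ ¬c = ext λ n → bit n (same n)
      where
      bit : ∀ n → stage f n ≡ stage f′ n → f n ≡ f′ n
      bit n eq with f n Bool.≟ f′ n
      ... | yes p = p
      ... | no neq = ⊥-elim (¬c (cut f n , (n , inj₂ refl) , (n , inj₂ cut≡) , λ v≡ → neq (
              trans (sym (value-decided f (cut f n) (suc n) (f n) (decides-cut f n)))
              (trans v≡ (value-decided f′ (cut f n) (suc n) (f′ n)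
                (subst (λ j → Decided e (proj₁ (stage f′ (suc n))) j (f′ n)) (sym cut≡) (decides-cut f′ n)))))))
        where
        cut≡ : cut f n ≡ cut f′ n
        cut≡ = cong (λ s → proj₁ (splitter s)) eq
      same : ∀ n → stage f n ≡ stage f′ n
      same zero    = refl
      same (suc n) = cong₂ child (same n) (bit n (same n))

    -- König: 2^ω is not a union of countably many sets each of size < 2^ω, so the
    -- fewer than 2^ω countable sets of nodes cannot lie above all branches.
    avoiding-branch : {W : Set} (node : W → ℕ → Node O) →
      (∀ (φ : 𝒫 ℕ → W) → ¬ (∀ {x y} → node (φ x) ≡ node (φ y) → x ≡ y)) →
      ∃[ f ] ∀ γ l → ¬ (branch f ⊑ node γ l)
    avoiding-branch {W} node narrow = by-contradiction λ none →
      let covered : ∀ f → ∃[ γ ] ∃[ l ] branch f ⊑ node γ l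
          covered f = by-contradiction λ ¬c → none (f , λ γ l le → ¬c (γ , l , le))
      in König (λ f → proj₁ (covered f)) (λ f → proj₁ (proj₂ (covered f)))
               (λ {f} {f′} φ≡ ψ≡ → branches-clash f f′ λ { (j , d , d′ , neq) →
                  let le  = proj₂ (proj₂ (covered f)) j d
                      le′ = proj₂ (proj₂ (covered f′)) j d′ in
                  neq (trans (proj₂ le) (trans (cong₂ (λ ν l → val (ν l) j) φ≡ ψ≡) (sym (proj₂ le′)))) })
      where
      column : ℕ → 𝒫 ℕ → 𝒫 ℕ
      column n f m = f (pair n m)
      König : (φ : 𝒫 ℕ → W) (ψ : 𝒫 ℕ → ℕ) →
              ¬ (∀ {f f′} → node (φ f) ≡ node (φ f′) → ψ f ≡ ψ f′ → f ≡ f′)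
      König φ ψ inj with em {∃[ n ] ∀ y → ∃[ f ] ψ f ≡ n × column n f ≡ y}
      -- Here the `f` with `ψ f ≡ n` realise every column, and picking one `f` per column
      -- contradicts `narrow`.
      ... | yes (n , onto) =
        narrow (λ y → φ (proj₁ (onto y)))
               (λ {y} {y′} eq →
                  let (f , ψf , cf) = onto y ; (f′ , ψf′ , cf′) = onto y′ in
                  trans (sym cf) (trans (cong (column n) (inj eq (trans ψf (sym ψf′)))) cf′))
      -- The missed columns are glued into one `f*`, whose column at `ψ f*` is both missed and
      -- realised.
      ... | no ¬onto = proj₂ (missed (ψ f*)) (f* , refl , ext λ m →
                cong (λ { (n , m) → proj₁ (missed n) m }) (unpair-pair (ψ f*) m))
        where
        missed : ∀ n → ∃[ y ] ¬ (∃[ f ] ψ f ≡ n × column n f ≡ y)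
        missed n = ¬∀⇒∃¬ λ all → ¬onto (n , all)
        f* : 𝒫 ℕ
        f* k = let (n , m) = unpair k in proj₁ (missed n) m

  -- Sets with pieces at nodes, and disjointness from clashes.

  record Stage : Set₁ where
    field
      set   : Sub
      piece : ℕ → Sub
      node  : ℕ → Node O
  open Stage

  At : Sub → Node O → Set
  At x τ = ∀ j → Dom τ j → x ⊆* side e j (val τ j)

  AtModulo : Sub → (ℕ → Sub) → Node O → Set
  AtModulo x X τ = ∀ j → Dom τ j →
    ∃[ K ] ∀^∞ (λ m → x m → side e j (val τ j) m ⊎ ∃[ k ] k < K × X k m)

  -- The pieces of a set may sit at different nodes (node (1 + k) for piece k), converging to node 0.
  record Coherent (s : Stage) : Set where
    field
      piece⊆set : ∀ k m → piece s k m → set s m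
      piece-at  : ∀ k → At (piece s k) (node s (suc k))
      set-at    : AtModulo (set s) (piece s) (node s 0)
  open Coherent

  -- A clash with `node s 0` puts `y` and `set s` on opposite sides, up to finitely many `X k` and
  -- pieces of `s`. Those pieces are separated from `y` by clashes with their own nodes, and the
  -- `X k` from `set s` by assumption.
  disjoint-by-nodes : ∀ {y} X τ s → AtModulo y X τ → Coherent s → (∀ l → Clash τ (node s l)) →
    (∀ k → Fin (λ m → X k m × set s m)) → Fin (λ m → y m × set s m)
  disjoint-by-nodes {y} X τ s y-at coh clash X-fin =
    let (j , d , d′ , v≢w) = clash 0
        (K , yK) = y-at j d
        (L , sL) = set-at coh j d′
    in ∀^∞-zip (λ m f g → f g)
         (∀^∞-zip (λ m hy (hs , pf) xf (ym , sm) → rule-out v≢w (hy ym) (hs sm) xf pf ym sm)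
            yK (∀^∞-zip (λ _ → _,_) sL (∀^∞-< L (λ l _ → piece-fin l))))
         (∀^∞-< K (λ k _ → X-fin k))
    where
    rule-out : ∀ {j v w m K L} → v ≢ w → side e j v m ⊎ ∃[ k ] k < K × X k m →
               side e j w m ⊎ ∃[ l ] l < L × piece s l m →
               (∀ k → k < K → ¬ (X k m × set s m)) → (∀ l → l < L → ¬ (y m × piece s l m)) →
               y m → set s m → ⊥
    rule-out v≢w (inj₂ (k , k<K , x)) _ xf _ ym sm = xf k k<K (x , sm)
    rule-out v≢w (inj₁ _) (inj₂ (l , l<L , p)) _ pf ym sm = pf l l<L (ym , p)
    rule-out v≢w (inj₁ a) (inj₁ b) _ _ _ _ = side-clash e _ _ _ v≢w a b
    piece-fin : ∀ l → Fin (λ m → y m × piece s l m)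
    piece-fin l =
      let (j , d , d′ , v≢w) = clash (suc l)
          (K , yK) = y-at j d
      in ∀^∞-zip (λ m f g → f g)
           (∀^∞-zip (λ m hy hp xf (ym , pm) → exclude (hy ym) (λ a → side-clash e j _ _ v≢w a (hp pm))
                                                λ k k<K x → xf k k<K (x , piece⊆set coh l m pm))
              yK (piece-at coh l j d′))
           (∀^∞-< K (λ k _ → X-fin k))
      where
      exclude : ∀ {A : Set} {m K} → A ⊎ ∃[ k ] k < K × X k m → ¬ A → (∀ k → k < K → ¬ X k m) → ⊥
      exclude (inj₁ a) ¬a _ = ¬a a
      exclude (inj₂ (k , k<K , x)) _ h = h k k<K x

  -- The family built so far and its extension by one stage.

  module Family {W : Set} (C : ℕ → Sub) (S : W → Stage) where

    Member : Set
    Member = ℕ ⊎ W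

    mem : Member → Sub
    mem (inj₁ c) = C c
    mem (inj₂ γ) = set (S γ)

    -- Membership in `ℐ⁺`, phrased with lists of indices in place of lists of sets.
    Positive : Sub → Set
    Positive b = ∀ L → Inf (λ m → b m × ¬ Any (λ x → mem x m) L)

    Avoids : Node O → Set
    Avoids τ = ∀ γ l → ¬ (τ ⊑ node (S γ) l)

    Restricts : Node O → W → Set
    Restricts τ γ = ∃[ l ] ∃[ i ] Dom τ i × IsRestriction (node (S γ) l) τ i

    record Admissible (s : Stage) : Set where
      field
        is-coherent : Coherent s
        infinite    : Inf (set s)
        disjoint    : ∀ x → Fin (λ m → set s m × mem x m)
        avoids      : ∀ l → Avoids (node s l)

  module Extension {W : Set} (C : ℕ → Sub) (S : W → Stage)
    (coherent  : ∀ γ → Coherent (S γ))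
    (exclusive : ∀ γ γ′ l l′ → node (S γ) l ⊑ node (S γ′) l′ →
                 node (S γ′) l′ ⊑ node (S γ) l → S γ ≡ S γ′)
    (narrow    : ∀ (φ : 𝒫 ℕ → W) → ¬ (∀ {x y} → node (S (φ x)) ≡ node (S (φ y)) → x ≡ y))
    where
    open Family C S

    -- Distinct earlier stages restrict τ to distinct lengths, hence fewer than 𝔟 of them do.
    dominator : ∀ τ q → (∀ j → Dom τ j → Decided e q j (val τ j)) →
      (∀ x → ∀^∞ (λ k → Fin (λ m → q k m × mem x m))) →
      ∃[ g ] (∀ j → Dom τ j → Escapes q g (side e j (not (val τ j)))) ×
             (∀ c → Escapes q g (C c)) ×
             (∀ γ → Restricts τ γ → Escapes q g (set (S γ)))
    dominator τ q dec fin = g ,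
      (λ j d → escapes q _ (decided-fin e q j (val τ j) (dec j d))
                 (≤*-trans (proj₂ small₁ j d) (0 , λ k _ → ≤-trans (m≤m⊔n _ _) (m≤m⊔n _ _)))) ,
      (λ c → escapes q _ (fin (inj₁ c))
                 (≤*-trans (proj₂ small₂ c) (0 , λ k _ → ≤-trans (m≤n⊔m (proj₁ small₁ k) _) (m≤m⊔n _ _)))) ,
      λ { γ (l , i , d , r) → escapes q _ (fin (inj₂ γ))
            (≤*-trans (subst (_≤* proj₁ small₃) (pick-bounds em r) (proj₂ small₃ i d))
                      (0 , λ k _ → m≤n⊔m (proj₁ small₁ k ⊔ proj₁ small₂ k) _)) }
      where
      At-length : J → Set
      At-length i = ∃[ γ ] ∃[ l ] IsRestriction (node (S γ) l) τ i
      pick : ∀ {i} → Dec (At-length i) → ℕ → ℕ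
      pick (yes (γ , _)) = bounds q (set (S γ))
      pick (no _)        = λ _ → 0
      pick-bounds : ∀ {i γ l} (D : Dec (At-length i)) → IsRestriction (node (S γ) l) τ i →
                    pick D ≡ bounds q (set (S γ))
      pick-bounds {i} {γ} {l} (no none) r = ⊥-elim (none (γ , l , r))
      pick-bounds {i} {γ} {l} (yes (γ′ , l′ , r′)) r =
        -- Restrictions of `τ` to the same length agree as nodes, so `exclusive` identifies their
        -- stages and the choice of `γ′` is immaterial.
        cong (λ s → bounds q (set s))
          (exclusive γ′ γ l′ l
            (restriction-⊑ {node (S γ′) l′} {node (S γ) l} {τ} r′ r)
            (restriction-⊑ {node (S γ) l} {node (S γ′) l′} {τ} r r′))
      small₁ = small τ (λ j → bounds q (side e j (not (val τ j))))
      small₂ = countable-bound (λ c → bounds q (C c))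
      small₃ = small τ (λ i → pick (em {At-length i}))
      g : ℕ → ℕ
      g k = (proj₁ small₁ k ⊔ proj₁ small₂ k) ⊔ proj₁ small₃ k

    -- Since `τ` avoids the nodes of `S γ`, each of them clashes with `τ` or restricts it. If all
    -- clash, the clashes suffice; a restricting one is left to the last hypothesis, which
    -- domination supplies.
    disjoint-from-earlier : ∀ {y} X τ → AtModulo y X τ → Avoids τ → ∀ γ →
      (∀ k → Fin (λ m → X k m × set (S γ) m)) →
      (Restricts τ γ → Fin (λ m → y m × set (S γ) m)) → Fin (λ m → y m × set (S γ) m)
    disjoint-from-earlier X τ y-at avoid γ X-fin restr with em {Restricts τ γ}
    ... | yes r = restr r
    ... | no ¬r = disjoint-by-nodes X τ (S γ) y-at (coherent γ) clash X-fin
      where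
      clash : ∀ l → Clash τ (node (S γ) l)
      clash l with ⋢⇒clash-or-restriction τ (node (S γ) l) (avoid γ l)
      ... | inj₁ c = c
      ... | inj₂ r = ⊥-elim (¬r (l , r))

    record Thread (p : ℕ → Sub) : Set₁ where
      field
        τ      : Node O
        q      : ℕ → Sub
        q-inf  : ∀ k → Inf (q k)
        q-dec  : ∀ j → Dom τ j → Decided e q j (val τ j)
        q-ref  : Refines q p
        avoids : Avoids τ

    thread : (p : Seq) → Thread (proj₁ p)
    thread p = record
      { τ = branch f ; q = diagonal f ; q-inf = diagonal-inf f ; q-dec = diagonal-at f
      ; q-ref = diagonal-refines f ; avoids = proj₂ avoiding }
      where
      open Branches p
      avoiding = avoiding-branch (λ γ → node (S γ)) narrow
      f = proj₁ avoiding

    module _ (almost-disjoint : ∀ x y → (∀ m → mem x m → mem y m) ⊎ Fin (λ m → mem x m × mem y m)) where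

      -- Provides infinite subsets of `b` such that every member meets only finitely many of them
      -- infinitely. While the remainder meets some member infinitely, that intersection is the next
      -- part and the member is removed; afterwards the remainder itself is repeated.
      module Spread (b : Sub) (positive : Positive b) where
        Remainder : List Member → Sub
        Remainder L m = b m × ¬ Any (λ y → mem y m) L

        Meets : List Member → Set
        Meets L = ∃[ x ] Inf (λ m → Remainder L m × mem x m)

        grow : ∀ L → Dec (Meets L) → List Member
        grow L (yes (x , _)) = x ∷ L
        grow L (no _)        = L

        part : ∀ L → Dec (Meets L) → Sub
        part L (yes (x , _)) m = Remainder L m × mem x m
        part L (no _)          = Remainder L

        part-inf : ∀ L D → Inf (part L D)
        part-inf L (yes (x , inf)) = inf
        part-inf L (no _)          = positive L

        part⊆remainder : ∀ L D {m} → part L D m → Remainder L m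
        part⊆remainder L (yes _) = proj₁
        part⊆remainder L (no _)  = id

        used : ℕ → List Member
        used zero    = []
        used (suc n) = grow (used n) em

        used-mono : ∀ {Q : Member → Set} {m n} → m ≤ n → Any Q (used m) → Any Q (used n)
        used-mono {n = zero} z≤n a = a
        used-mono {m = m} {suc n} m≤1+n a with m≤n⇒m<n∨m≡n m≤1+n
        ... | inj₂ refl = a
        ... | inj₁ m<1+n = later em (used-mono (s≤s⁻¹ m<1+n) a)
          where
          later : ∀ {Q : Member → Set} {L} D → Any Q L → Any Q (grow L D)
          later (yes _) = there
          later (no _)  = id

        parts : ℕ → Sub
        parts n = part (used n) em

        -- The part lies in the chosen `x`, so `y` meets `x` infinitely and is contained in it;
        -- listing `x` thus removes `y` as well.
        once : ∀ y n (D : Dec (Meets (used n))) → Inf (λ m → part (used n) D m × mem y m) →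
               (∀ m → mem y m → Any (λ x → mem x m) (grow (used n) D))
        once y n (no none) inf m ym = ⊥-elim (none (y , inf))
        once y n (yes (x , _)) inf m ym with almost-disjoint y x
        ... | inj₁ y⊆x = here (y⊆x m ym)
        ... | inj₂ fin =
          let (k , _ , ((_ , xk) , yk) , ¬both) = ∃^∞-∀^∞ inf fin 0 in ⊥-elim (¬both (yk , xk))

        parts-fin : ∀ y → ∀^∞ (λ n → Fin (λ m → parts n m × mem y m))
        parts-fin y with em {∃[ n ] Inf (λ m → parts n m × mem y m)}
        ... | no none = 0 , λ n _ → ¬∃^∞⇒∀^∞¬ λ inf → none (n , inf)
        ... | yes (n , inf) = suc n , λ k n<k → 0 , λ m _ (pm , ym) →
          proj₂ (part⊆remainder (used k) em pm) (used-mono n<k (once y n em inf m ym))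

      refine-fin : ∀ {p q} → Refines q p → ∀ x → ∀^∞ (λ k → Fin (λ m → p k m × mem x m)) →
                   ∀^∞ (λ k → Fin (λ m → q k m × mem x m))
      refine-fin r x fin = ∀^∞-map (λ _ → ∀^∞-map λ _ → uncurry)
        (∀^∞-refine (λ m → ¬ mem x m) r (∀^∞-map (λ _ → ∀^∞-map λ _ → curry) fin))

      record Selection (b : Sub) : Set₁ where
        field
          x        : Sub
          σ        : Node O
          infinite : Inf x
          x⊆b      : ∀ m → x m → b m
          x-at     : At x σ
          avoids   : Avoids σ
          disjoint : ∀ y → Fin (λ m → x m × mem y m)

      select : ∀ b → Positive b → Selection b
      select b positive = record
        { x = x ; σ = τ ; infinite = proj₁ x-props
        ; x⊆b = λ m xm → let (k , qm) = proj₁ (proj₂ x-props) m xm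
                             (n , _ , q⊆p) = q-ref k in
                         proj₁ (part⊆remainder (used n) em (q⊆p m qm))
        ; x-at = x-at ; avoids = avoids
        ; disjoint = λ { (inj₁ c) → x-fin _ (proj₁ (proj₂ (proj₂ dom)) c)
                       ; (inj₂ γ) →
                           disjoint-from-earlier (λ _ _ → ⊥) τ
                             (λ j d → 0 , ∀^∞-map (λ m h xm → inj₁ (h xm)) (x-at j d))
                             avoids γ (λ _ → 0 , λ _ _ → proj₁)
                             (λ r → x-fin _ (proj₂ (proj₂ (proj₂ dom)) γ r)) } }
        where
        open Spread b positive
        open Thread (thread (parts , λ n → part-inf (used n) em))
        dom = dominator τ q q-dec (λ y → refine-fin q-ref y (parts-fin y))
        thinned = thin q q-inf (proj₁ dom)
        x = proj₁ thinned
        x-props = proj₂ thinned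
        x-fin : ∀ z → Escapes q (proj₁ dom) z → Fin (λ m → x m × z m)
        x-fin = proj₂ (proj₂ x-props)
        x-at : At x τ
        x-at j d = ∀^∞-map (λ m h xm → other-side e j (val τ j) λ s → h (xm , s))
                     (x-fin _ (proj₁ (proj₂ dom) j d))

      module Union (b : ℕ → Sub) (sel : ∀ n → Selection (b n))
                   (t : Thread (λ n → Selection.x (sel n))) where
        open Selection hiding (avoids)
        open Thread t
        q-disjoint : ∀ k y → Fin (λ m → q k m × mem y m)
        q-disjoint k y = let (n , _ , q⊆x) = q-ref k in
          ∀^∞-map (λ m h (qm , ym) → h (q⊆x m qm , ym)) (disjoint (sel n) y)
        dom = dominator τ q q-dec (λ y → 0 , λ k _ → q-disjoint k y)
        g = proj₁ dom
        s : Stage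
        s = record
          { set   = λ m → ∃[ k ] q k m × g k ≤ m
          ; piece = λ k m → q k m × g k ≤ m
          -- Piece `k` lies in the selected set that contains `q k`, and inherits its node.
          ; node  = λ { zero → τ ; (suc k) → σ (sel (proj₁ (q-ref k))) } }
        s-fin : ∀ z → Escapes q g z → (∀ k → Fin (λ m → q k m × z m)) → Fin (λ m → set s m × z m)
        s-fin z (N , esc) fin = ∀^∞-map (λ { m h ((k , qm , g≤m) , zm) → sort h k qm g≤m zm })
                                        (∀^∞-< N (λ k _ → fin k))
          where
          sort : ∀ {m} → (∀ k → k < N → ¬ (q k m × z m)) → ∀ k → q k m → g k ≤ m → ¬ z m
          sort {m} h k qm g≤m zm with k <? N
          ... | yes k<N = h k k<N (qm , zm)
          ... | no k≮N  = esc k (≮⇒≥ k≮N) m g≤m qm zm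
        s-at : AtModulo (set s) (piece s) τ
        s-at j d = let (N , esc) = proj₁ (proj₂ dom) j d in
          -- Pieces from index `N` on miss the wrong side; the earlier ones are the exceptions
          -- allowed by `AtModulo`.
          N , 0 , λ { m _ (k , qm , g≤m) → sort N esc k qm g≤m }
          where
          sort : ∀ N → (∀ k → N ≤ k → ∀ m → g k ≤ m → q k m → ¬ side e j (not (val τ j)) m) →
                 ∀ {m} k → q k m → g k ≤ m → side e j (val τ j) m ⊎ ∃[ k ] k < N × piece s k m
          sort N esc {m} k qm g≤m with k <? N
          ... | yes k<N = inj₂ (k , k<N , qm , g≤m)
          ... | no k≮N  = inj₁ (other-side e j (val τ j) (esc k (≮⇒≥ k≮N) m g≤m qm))
        s-disjoint : ∀ y → Fin (λ m → set s m × mem y m)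
        s-disjoint (inj₁ c) = s-fin _ (proj₁ (proj₂ (proj₂ dom)) c) (λ k → q-disjoint k (inj₁ c))
        s-disjoint (inj₂ γ) =
          disjoint-from-earlier (piece s) τ s-at avoids γ
            (λ k → ∀^∞-map (λ m h ((qm , _) , ym) → h (qm , ym)) (q-disjoint k (inj₂ γ)))
            (λ r → s-fin _ (proj₂ (proj₂ (proj₂ dom)) γ r) (λ k → q-disjoint k (inj₂ γ)))
        admissible : Admissible s
        admissible = record
          { is-coherent = record
              { piece⊆set = λ k m → k ,_
              ; piece-at  = λ k j d → let (n , _ , q⊆x) = q-ref k in
                  ∀^∞-map (λ m h (qm , _) → h (q⊆x m qm)) (x-at (sel n) j d)
              ; set-at    = s-at }
          ; infinite = λ N → let (m , le , qm) = q-inf 0 (N ⊔ g 0) in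
              m , m⊔n≤o⇒m≤o N (g 0) le , 0 , qm , m⊔n≤o⇒n≤o N (g 0) le
          ; disjoint = s-disjoint
          ; avoids   = λ { zero → avoids ; (suc k) → Selection.avoids (sel (proj₁ (q-ref k))) } }

        meets : ∃^∞ (λ n → Inf (λ m → b n m × set s m))
        meets N =
          let (n , N≤n , q⊆x) = q-ref N in
          n , N≤n , λ M →
            let (m , le , qm) = q-inf N (M ⊔ g N) in
            m , m⊔n≤o⇒m≤o M (g N) le , x⊆b (sel n) m (q⊆x m qm) , N , qm , m⊔n≤o⇒n≤o M (g N) le

      extend : (b : ℕ → Sub) → (∀ n → Positive (b n)) →
               Σ Stage λ s → Admissible s × ∃^∞ (λ n → Inf (λ m → b n m × set s m))
      extend b positive = s , admissible , meets
        where
        sel : ∀ n → Selection (b n)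
        sel n = select (b n) (positive n)
        open Union b sel (thread ((λ n → Selection.x (sel n)) , λ n → Selection.infinite (sel n)))

-- Comprehension for `Bool`-valued subsets, and the well-ordering theorem.

module Sets (em : ∀ {P : Set} → Dec P) (ext : Extensionality 0ℓ 0ℓ) where

  ⌊_⌋ : {X : Set} → (X → Set) → 𝒫 X
  ⌊ Q ⌋ x = does (em {Q x})

  ⌊⌋-intro : {X : Set} (Q : X → Set) {x : X} → Q x → x ∈ ⌊ Q ⌋
  ⌊⌋-intro Q {x} q with em {Q x}
  ... | yes _ = tt
  ... | no ¬q = ¬q q

  ⌊⌋-elim : {X : Set} (Q : X → Set) {x : X} → x ∈ ⌊ Q ⌋ → Q x
  ⌊⌋-elim Q {x} t with em {Q x}
  ... | yes q = q

  infix 4 _⊆_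
  _⊆_ : {X : Set} → 𝒫 X → 𝒫 X → Set
  A ⊆ B = ∀ x → x ∈ A → x ∈ B

  ⊆-antisym : {X : Set} {A B : 𝒫 X} → A ⊆ B → B ⊆ A → A ≡ B
  ⊆-antisym {A = A} {B} A⊆B B⊆A = ext λ x → T-ext (A x) (B x) (A⊆B x) (B⊆A x)
    where
    T-ext : ∀ a b → (T a → T b) → (T b → T a) → a ≡ b
    T-ext true  true  f g = refl
    T-ext true  false f g = ⊥-elim (f tt)
    T-ext false true  f g = ⊥-elim (g tt)
    T-ext false false f g = refl

-- Zermelo: the sets obtained from ∅ by adding one chosen new element at a time and taking
-- unions form a chain; x ↦ (the largest of them that omits x) well-orders X.
module Zermelo (em : ∀ {P : Set} → Dec P) (ext : Extensionality 0ℓ 0ℓ) (X : Set) where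
  open WithEM em
  open Sets em ext

  -- The decision is a separate argument, so that lemmas can match on it while the chosen point
  -- stays fixed.
  IsNew : (A : 𝒫 X) → Dec (∃[ x ] ¬ (x ∈ A)) → X → Set
  IsNew A (yes (y , _)) x = x ≡ y
  IsNew A (no _)        x = ⊥

  New : 𝒫 X → X → Set
  New A = IsNew A em

  new-fresh : ∀ {A x} → New A x → ¬ (x ∈ A)
  new-fresh {A} {x} = go em
    where
    go : ∀ D → IsNew A D x → ¬ (x ∈ A)
    go (yes (_ , x∉A)) refl = x∉A

  new-unique : ∀ {A x y} → New A x → New A y → x ≡ y
  new-unique {A} = go em
    where
    go : ∀ {x y} D → IsNew A D x → IsNew A D y → x ≡ y
    go (yes _) refl refl = refl

  new-exists : ∀ {A x} → ¬ (x ∈ A) → ∃ (New A)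
  new-exists {A} {x} x∉A = go em
    where
    go : ∀ D → ∃ (IsNew A D)
    go (yes (y , _)) = y , refl
    go (no none)     = ⊥-elim (none (x , x∉A))

  infix 8 _⁺
  _⁺ : 𝒫 X → 𝒫 X
  A ⁺ = ⌊ (λ x → x ∈ A ⊎ New A x) ⌋

  old : ∀ {A} → A ⊆ A ⁺
  old {A} x x∈A = ⌊⌋-intro (λ x → x ∈ A ⊎ New A x) (inj₁ x∈A)

  new : ∀ {A x} → New A x → x ∈ A ⁺
  new {A} n = ⌊⌋-intro (λ x → x ∈ A ⊎ New A x) (inj₂ n)

  ⁺-cases : ∀ {A x} → x ∈ A ⁺ → x ∈ A ⊎ New A x
  ⁺-cases {A} = ⌊⌋-elim (λ x → x ∈ A ⊎ New A x)

  Some : 𝒫 (𝒫 X) → X → Set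
  Some F x = ∃[ A ] A ∈ F × x ∈ A

  data Tower : 𝒫 X → Set where
    grow  : ∀ {A} → Tower A → Tower (A ⁺)
    union : (F : 𝒫 (𝒫 X)) → (∀ A → A ∈ F → Tower A) → Tower ⌊ Some F ⌋

  Comparable : 𝒫 X → Set
  Comparable C = ∀ A → Tower A → A ⊆ C ⊎ C ⊆ A

  union-⊆ : ∀ {F C} → (∀ A → A ∈ F → A ⊆ C) → ⌊ Some F ⌋ ⊆ C
  union-⊆ {F} h x x∈ = let (A , A∈F , x∈A) = ⌊⌋-elim (Some F) x∈ in h A A∈F x x∈A

  ⊆-union : ∀ {F A} → A ∈ F → A ⊆ ⌊ Some F ⌋
  ⊆-union {F} {A} A∈F x x∈A = ⌊⌋-intro (Some F) (A , A∈F , x∈A)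

  union-cases : ∀ {F} {P : Set} {C} → (∀ A → A ∈ F → A ⊆ C ⊎ P) → ⌊ Some F ⌋ ⊆ C ⊎ P
  union-cases {F} {P} {C} h with em {P}
  ... | yes p = inj₂ p
  ... | no ¬p = inj₁ (union-⊆ λ A A∈F → left (h A A∈F))
    where
    left : ∀ {A} → A ⊆ C ⊎ P → A ⊆ C
    left (inj₁ s) = s
    left (inj₂ p) = ⊥-elim (¬p p)

  comparable-⁺ : ∀ {C} → Comparable C → ∀ A → Tower A → A ⊆ C ⊎ C ⁺ ⊆ A
  comparable-⁺ {C} cmp .(A ⁺) (grow {A} t) with comparable-⁺ cmp A t
  ... | inj₂ C⁺⊆A = inj₂ λ x x∈ → old x (C⁺⊆A x x∈)
  ... | inj₁ A⊆C with cmp (A ⁺) (grow t)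
  ...   | inj₁ A⁺⊆C = inj₁ A⁺⊆C
  -- Now `C` lies between `A` and `A ⁺`, which differ by at most one point; whether `C` has that
  -- point determines which of the two it equals.
  ...   | inj₂ C⊆A⁺ with em {∃[ x ] New A x × x ∈ C}
  ...     | yes (x , n , x∈C) = inj₁ λ y y∈ → back (⁺-cases y∈)
    where
    back : ∀ {y} → y ∈ A ⊎ New A y → y ∈ C
    back (inj₁ y∈A) = A⊆C _ y∈A
    back (inj₂ n′)  = subst (_∈ C) (new-unique n n′) x∈C
  ...     | no none = inj₂ (subst (λ D → C ⁺ ⊆ D ⁺) (⊆-antisym C⊆A A⊆C) (λ _ x∈ → x∈))
    where
    C⊆A : C ⊆ A
    C⊆A x x∈C with ⁺-cases (C⊆A⁺ x x∈C)
    ... | inj₁ x∈A = x∈A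
    ... | inj₂ n   = ⊥-elim (none (x , n , x∈C))
  comparable-⁺ cmp _ (union F ts) = union-cases λ A A∈F → lift-right A∈F (comparable-⁺ cmp A (ts A A∈F))
    where
    lift-right : ∀ {A C} → A ∈ F → A ⊆ C ⊎ C ⁺ ⊆ A → A ⊆ C ⊎ C ⁺ ⊆ ⌊ Some F ⌋
    lift-right A∈F (inj₁ s) = inj₁ s
    lift-right A∈F (inj₂ s) = inj₂ λ x x∈ → ⊆-union A∈F x (s x x∈)

  comparable : ∀ {C} → Tower C → Comparable C
  comparable (grow t) A tA with comparable-⁺ (comparable t) A tA
  ... | inj₁ A⊆C  = inj₁ λ x x∈ → old x (A⊆C x x∈)
  ... | inj₂ C⁺⊆A = inj₂ C⁺⊆A
  comparable (union F ts) A tA = Sum.swap (union-cases λ C C∈F → turn C∈F (comparable (ts C C∈F) A tA))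
    where
    turn : ∀ {C} → C ∈ F → A ⊆ C ⊎ C ⊆ A → C ⊆ A ⊎ A ⊆ ⌊ Some F ⌋
    turn C∈F (inj₁ s) = inj₂ λ x x∈ → ⊆-union C∈F x (s x x∈)
    turn C∈F (inj₂ s) = inj₁ s

  chain : ∀ {A C} → Tower A → Tower C → A ⊆ C ⊎ C ⁺ ⊆ A
  chain tA tC = comparable-⁺ (comparable tC) _ tA

  Omits : X → 𝒫 X → Set
  Omits x A = Tower A × ¬ (x ∈ A)

  before : X → 𝒫 X
  before x = ⌊ Some ⌊ Omits x ⌋ ⌋

  before-tower : ∀ x → Tower (before x)
  before-tower x = union ⌊ Omits x ⌋ λ A A∈ → proj₁ (⌊⌋-elim (Omits x) A∈)

  before-irrefl : ∀ x → ¬ (x ∈ before x)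
  before-irrefl x x∈ =
    let (A , A∈ , x∈A) = ⌊⌋-elim (Some ⌊ Omits x ⌋) x∈ in proj₂ (⌊⌋-elim (Omits x) A∈) x∈A

  omits-before : ∀ {A x} → Tower A → ¬ (x ∈ A) → A ⊆ before x
  omits-before {A} {x} t x∉A = ⊆-union (⌊⌋-intro (Omits x) (t , x∉A))

  -- Otherwise `before x ⁺` would still omit `x` and hence lie inside `before x`, although it has a
  -- new point.
  before-new : ∀ x → New (before x) x
  before-new x with em {x ∈ before x ⁺}
  ... | yes x∈ = right (⁺-cases x∈)
    where
    right : x ∈ before x ⊎ New (before x) x → New (before x) x
    right (inj₁ x∈) = ⊥-elim (before-irrefl x x∈)
    right (inj₂ n)  = n
  ... | no x∉ =
    let (y , n) = new-exists (before-irrefl x) in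
    ⊥-elim (new-fresh n (omits-before (grow (before-tower x)) x∉ y (new n)))

  before-mono : ∀ {y z} → y ∈ before z → before y ⊆ before z
  before-mono {y} {z} y∈ with chain (before-tower y) (before-tower z)
  ... | inj₁ s = s
  ... | inj₂ s = ⊥-elim (before-irrefl y (s y (old y y∈)))

  wellOrder : WellOrder X
  wellOrder = record
    { _≺_     = λ x y → x ∈ before y
    ; ≺-trans = λ x∈ y∈ → before-mono y∈ _ x∈
    ; compare = cmp
    ; wf      = λ x → tower-acc (grow (before-tower x)) x (new (before-new x)) }
    where
    cmp : ∀ x y → x ∈ before y ⊎ x ≡ y ⊎ y ∈ before x
    cmp x y with chain (before-tower x) (before-tower y) | chain (before-tower y) (before-tower x)
    ... | inj₂ s | _      = inj₂ (inj₂ (s y (new (before-new y))))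
    ... | inj₁ _ | inj₂ s = inj₁ (s x (new (before-new x)))
    ... | inj₁ s | inj₁ r = inj₂ (inj₁ (new-unique
            (subst (λ A → New A x) (⊆-antisym s r) (before-new x)) (before-new y)))
    tower-acc : ∀ {A} → Tower A → ∀ x → x ∈ A → Acc (λ x y → x ∈ before y) x
    tower-acc (grow {A} t) x x∈ with ⁺-cases x∈
    ... | inj₁ x∈A = tower-acc t x x∈A
    ... | inj₂ n   = acc λ {y} y∈ → tower-acc t y (inside y y∈)
      where
      inside : before x ⊆ A
      inside with chain (before-tower x) t
      ... | inj₁ s = s
      ... | inj₂ s = ⊥-elim (before-irrefl x (s x (new n)))
    tower-acc (union F ts) x x∈ =
      let (A , A∈F , x∈A) = ⌊⌋-elim (Some F) x∈ in tower-acc (ts A A∈F) x x∈A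

  open WellOrder wellOrder using (_≺_)

  Bounds : X → Set
  Bounds δ = Σ (X → X) λ φ → (∀ {x y} → φ x ≡ φ y → x ≡ y) × (∀ x → φ x ≺ δ)

  -- If `X` injects into a proper segment, take the least such `δ` and pull the order back along the
  -- injection `φ`. An injection below `ε` in the new order would give one below `φ ε`, against
  -- minimality.
  initialOrder : Σ (WellOrder X) λ O →
    ∀ (φ : X → X) → (∀ {x y} → φ x ≡ φ y → x ≡ y) → ∀ δ → ¬ (∀ x → WellOrder._≺_ O (φ x) δ)
  initialOrder with em {∃ Bounds}
  ... | no none = wellOrder , λ φ inj δ φ≺δ → none (δ , φ , inj , φ≺δ)
  ... | yes some =
    let (δ , (φ , inj , φ≺δ) , min) = least wellOrder Bounds some in
    pullback wellOrder φ inj , λ ψ ψ-inj ε ψ≺ε →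
      min (φ ε) (φ≺δ ε) ((λ x → φ (ψ x)) , (λ eq → ψ-inj (inj eq)) , ψ≺ε)

-- The Cantor-Bernstein theorem for subsets.

subset-≡ : {X : Set} {A : 𝒫 X} {x y : ⟦ A ⟧} → proj₁ x ≡ proj₁ y → x ≡ y
subset-≡ {x = x , _} refl = cong (x ,_) (T-irrelevant _ _)

T-not⇒¬T : ∀ {c} → T (not c) → ¬ T c
T-not⇒¬T {false} _ ()

module Bernstein (em : ∀ {P : Set} → Dec P) {X : Set} (A : 𝒫 X) (f : X → X)
  (f-inj : ∀ {x y} → f x ≡ f y → x ≡ y) (f∈A : ∀ x → f x ∈ A) where
  open WithEM em

  iterate : ℕ → X → X
  iterate zero    x = x
  iterate (suc n) x = f (iterate n x)

  -- The forward orbit of the complement of `A`: moving exactly these points by `f` yields a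
  -- bijection from `X` onto `A`.
  Moved : X → Set
  Moved x = ∃[ n ] ∃[ y ] ¬ (y ∈ A) × iterate n y ≡ x

  shift : ∀ x → Dec (Moved x) → X
  shift x (yes _) = f x
  shift x (no _)  = x

  shift∈A : ∀ x D → shift x D ∈ A
  shift∈A x (yes _) = f∈A x
  shift∈A x (no fixed) = by-contradiction λ x∉A → fixed (0 , x , x∉A , refl)

  moved-f : ∀ {x} → Moved x → Moved (f x)
  moved-f (n , y , y∉A , eq) = suc n , y , y∉A , cong f eq

  shift-inj : ∀ {x y} D E → shift x D ≡ shift y E → x ≡ y
  shift-inj (yes _) (yes _) eq = f-inj eq
  shift-inj (no _)  (no _)  eq = eq
  shift-inj (yes m) (no ¬m) eq = ⊥-elim (¬m (subst Moved eq (moved-f m)))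
  shift-inj (no ¬m) (yes m) eq = ⊥-elim (¬m (subst Moved (sym eq) (moved-f m)))

  shift-yes : ∀ {x} D → Moved x → shift x D ≡ f x
  shift-yes (yes _) m = refl
  shift-yes (no ¬m) m = ⊥-elim (¬m m)

  shift-no : ∀ {x} D → ¬ Moved x → shift x D ≡ x
  shift-no (yes m) ¬m = ⊥-elim (¬m m)
  shift-no (no _)  _  = refl

  shift-onto : ∀ a → a ∈ A → ∃[ x ] shift x em ≡ a
  shift-onto a a∈A with em {Moved a}
  ... | no ¬m = a , shift-no em ¬m
  ... | yes (zero , y , y∉A , refl)  = ⊥-elim (y∉A a∈A)
  ... | yes (suc n , y , y∉A , refl) = iterate n y , shift-yes em (n , y , y∉A , refl)

  bijection : ⟦ A ⟧ ↔ X
  bijection = mk↔ₛ′ to from to-from from-to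
    where
    to : ⟦ A ⟧ → X
    to (a , a∈A) = proj₁ (shift-onto a a∈A)
    from : X → ⟦ A ⟧
    from x = shift x em , shift∈A x em
    to-from : ∀ x → to (from x) ≡ x
    to-from x = shift-inj em em (proj₂ (shift-onto (shift x em) (shift∈A x em)))
    from-to : ∀ a → from (to a) ≡ a
    from-to (a , a∈A) = subset-≡ (proj₂ (shift-onto a a∈A))

-- Recursion along a well-order of `𝒫 ℕ`, and the resulting family.

module Construction (em : ∀ {P : Set} → Dec P) (em₁ : ∀ {P : Set₁} → Dec P)
  (ext : Extensionality 0ℓ 0ℓ) (ext₁ : Extensionality 0ℓ (lsuc 0ℓ))
  {J : Set} (O : WellOrder J) (e : J → Sub) (seg : ∀ i → Small (λ j → WellOrder._≺_ O j i))
  (splitting : ∀ p → (∀ n → Inf (p n)) → ∃ (Splitsω e p)) where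
  open WithEM em
  open Sets em ext
  open Tree em ext O e seg splitting
  open Node
  open Stage

  initial = Zermelo.initialOrder em ext (𝒫 ℕ)
  open WellOrder (proj₁ initial)

  -- The columns of ℕ × ℕ are put into the family to keep ℕ itself positive at every stage.
  column : ℕ → Sub
  column c m = proj₁ (unpair m) ≡ c

  column-inf : ∀ c → Inf (column c)
  column-inf c m = pair c m , y≤pair c m , cong proj₁ (unpair-pair c m)

  column-disjoint : ∀ {c d} → c ≢ d → Fin (λ m → column c m × column d m)
  column-disjoint c≢d = 0 , λ { m _ (refl , refl) → c≢d refl }

  decode : 𝒫 ℕ → ℕ → 𝒫 ℕ
  decode x n m = x (pair n m)

  encode : (ℕ → 𝒫 ℕ) → 𝒫 ℕ
  encode b k = uncurry b (unpair k)

  decode-encode : ∀ b → decode (encode b) ≡ b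
  decode-encode b = ext λ n → ext λ m → cong (uncurry b) (unpair-pair n m)

  Earlier : 𝒫 ℕ → Set
  Earlier δ = Σ (𝒫 ℕ) (_≺ δ)

  Spec : ∀ δ → (Earlier δ → Stage) → Stage → Set
  Spec δ S s = Admissible s ×
    ((∀ n → Positive (_∈ decode δ n)) → ∃^∞ (λ n → Inf (λ m → m ∈ decode δ n × set s m)))
    where open Family column S

  choose : ∀ {δ S} → Dec (Σ Stage (Spec δ S)) → Stage
  choose (yes (s , _)) = s
  -- A placeholder that makes the recursion total; `spec-exists` excludes this case.
  choose (no _)        = record
    { set = λ _ → ⊥ ; piece = λ _ _ → ⊥
    ; node = λ _ → record { Dom = λ _ → ⊥ ; lower = λ _ () ; small = λ _ → (λ _ → 0) , λ _ () ; val = λ _ → true } }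

  choose-spec : ∀ {δ S} (D : Dec (Σ Stage (Spec δ S))) → Σ Stage (Spec δ S) → Spec δ S (choose D)
  choose-spec (yes (_ , p)) _ = p
  choose-spec (no none)     s = ⊥-elim (none s)

  step : ∀ δ → WF.WfRec _≺_ (λ _ → Stage) δ → Stage
  step δ rec = choose {δ} {λ (_ , γ≺δ) → rec γ≺δ} em₁

  stages : 𝒫 ℕ → Stage
  stages = WF.All.wfRec wf _ (λ _ → Stage) step

  stages-unfold : ∀ δ → stages δ ≡ step δ (λ {γ} _ → stages γ)
  stages-unfold δ = WF.FixPoint.unfold-wfRec wf (λ _ → Stage) step
    (λ δ {r} {r′} eq → cong (λ (r : WF.WfRec _≺_ (λ _ → Stage) δ) → step δ r)
       (implicit-extensionality ext₁ λ {γ} → ext₁ λ γ≺δ → eq γ≺δ)) {δ}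

  earlier : ∀ δ → Earlier δ → Stage
  earlier δ (γ , _) = stages γ

  module _ (δ : 𝒫 ℕ) (specs : ∀ {γ} → γ ≺ δ → Spec γ (earlier γ) (stages γ)) where
    open Family column (earlier δ)
    private
      module Earlier-admissible (γ : Earlier δ) =
        Family.Admissible (proj₁ (specs (proj₂ γ)))
      open Earlier-admissible

    coherent : ∀ γ → Coherent (earlier δ γ)
    coherent = is-coherent

    -- Of two different indices the later has an admissible stage, none of whose nodes is `⊑` a node
    -- of the earlier one.
    exclusive : ∀ γ γ′ l l′ → node (earlier δ γ) l ⊑ node (earlier δ γ′) l′ →
                node (earlier δ γ′) l′ ⊑ node (earlier δ γ) l → earlier δ γ ≡ earlier δ γ′
    exclusive g@(γ , _) g′@(γ′ , _) l l′ le ge with compare γ γ′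
    ... | inj₁ γ≺γ′        = ⊥-elim (avoids g′ l′ (γ , γ≺γ′) l ge)
    ... | inj₂ (inj₁ refl) = refl
    ... | inj₂ (inj₂ γ′≺γ) = ⊥-elim (avoids g l (γ′ , γ′≺γ) l′ le)

    narrow : (φ : 𝒫 ℕ → Earlier δ) →
             ¬ (∀ {x y} → node (earlier δ (φ x)) ≡ node (earlier δ (φ y)) → x ≡ y)
    narrow φ inj = proj₂ initial (λ x → proj₁ (φ x)) (λ eq → inj (cong (λ γ → node (stages γ)) eq))
                                 δ (λ x → proj₂ (φ x))

    almost-disjoint : ∀ x y → (∀ m → mem x m → mem y m) ⊎ Fin (λ m → mem x m × mem y m)
    almost-disjoint (inj₁ c) (inj₁ d) with c ≟ d
    ... | yes refl = inj₁ λ _ → id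
    ... | no c≢d   = inj₂ (column-disjoint c≢d)
    almost-disjoint (inj₁ c) (inj₂ γ) = inj₂ (∀^∞-map (λ _ h (p , q) → h (q , p)) (disjoint γ (inj₁ c)))
    almost-disjoint (inj₂ γ) (inj₁ c) = inj₂ (disjoint γ (inj₁ c))
    almost-disjoint (inj₂ g@(γ , _)) (inj₂ g′@(γ′ , _)) with compare γ γ′
    ... | inj₁ γ≺γ′        = inj₂ (∀^∞-map (λ _ h (p , q) → h (q , p)) (disjoint g′ (inj₂ (γ , γ≺γ′))))
    ... | inj₂ (inj₁ refl) = inj₁ λ _ → id
    ... | inj₂ (inj₂ γ′≺γ) = inj₂ (disjoint g (inj₂ (γ′ , γ′≺γ)))

    late-columns-miss : ∀ L → ∃[ N ] ∀ c → N ≤ c →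
      ∀^∞ (λ m → column c m → ¬ Any (λ x → mem x m) L)
    late-columns-miss [] = 0 , λ _ _ → 0 , λ { _ _ _ () }
    late-columns-miss (x ∷ L) =
      let (N , h)  = late-columns-miss L
          (N′ , h′) = miss x in
      N ⊔ N′ , λ c le → ∀^∞-zip (λ { m f g cm (here xm) → g (cm , xm) ; m f g cm (there a) → f cm a })
        (h c (m⊔n≤o⇒m≤o N N′ le)) (h′ c (m⊔n≤o⇒n≤o N N′ le))
      where
      miss : ∀ x → ∃[ N ] ∀ c → N ≤ c → Fin (λ m → column c m × mem x m)
      miss (inj₁ d) = suc d , λ c d<c → column-disjoint (λ { refl → <-irrefl refl d<c })
      miss (inj₂ γ) = 0 , λ c _ → ∀^∞-map (λ _ h (p , q) → h (q , p)) (disjoint γ (inj₁ c))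

    full-positive : Positive (λ _ → ⊤)
    full-positive L =
      let (N , h) = late-columns-miss L in
      ∃^∞-map (λ { m (cm , f) → tt , f cm }) (∃^∞-∀^∞ (column-inf N) (h N ≤-refl))

    spec-exists : Σ Stage (Spec δ (earlier δ))
    spec-exists with em {∀ n → Positive (_∈ decode δ n)}
    ... | yes pos = let (s , adm , meets) = extend almost-disjoint (λ n → _∈ decode δ n) pos in
                    s , adm , λ _ → meets
      where open Extension column (earlier δ) coherent exclusive narrow
    -- The code lists some set that is not positive. The constant sequence ℕ still gives an
    -- admissible stage, so every code contributes a member.
    ... | no ¬pos = let (s , adm , _) = extend almost-disjoint (λ _ _ → ⊤) (λ _ → full-positive) in
                    s , adm , λ pos → ⊥-elim (¬pos pos)
      where open Extension column (earlier δ) coherent exclusive narrow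

  spec : ∀ δ → Spec δ (earlier δ) (stages δ)
  spec δ = go (wf δ)
    where
    go : ∀ {δ} → Acc _≺_ δ → Spec δ (earlier δ) (stages δ)
    go {δ} (acc rs) = subst (Spec δ (earlier δ)) (sym (stages-unfold δ))
      (choose-spec em₁ (spec-exists δ λ γ≺δ → go (rs γ≺δ)))

  module Adm (δ : 𝒫 ℕ) = Family.Admissible (proj₁ (spec δ))

  later-disjoint : ∀ {γ δ} → γ ≺ δ → Fin (λ m → set (stages δ) m × set (stages γ) m)
  later-disjoint {γ} {δ} γ≺δ = Adm.disjoint δ (inj₂ (γ , γ≺δ))

  stages-disjoint : ∀ {γ δ} → γ ≢ δ → Fin (λ m → set (stages γ) m × set (stages δ) m)
  stages-disjoint {γ} {δ} γ≢δ with compare γ δ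
  ... | inj₁ γ≺δ        = ∀^∞-map (λ _ h (p , q) → h (q , p)) (later-disjoint γ≺δ)
  ... | inj₂ (inj₁ eq)  = ⊥-elim (γ≢δ eq)
  ... | inj₂ (inj₂ δ≺γ) = later-disjoint δ≺γ

  sets : ℕ ⊎ 𝒫 ℕ → Sub
  sets (inj₁ c) = column c
  sets (inj₂ γ) = set (stages γ)

  sets-inf : ∀ x → Inf (sets x)
  sets-inf (inj₁ c) = column-inf c
  sets-inf (inj₂ γ) = Adm.infinite γ

  sets-disjoint : ∀ x y → x ≢ y → Fin (λ m → sets x m × sets y m)
  sets-disjoint (inj₁ c) (inj₁ d) x≢y = column-disjoint λ { refl → x≢y refl }
  sets-disjoint (inj₁ c) (inj₂ γ) x≢y = ∀^∞-map (λ _ h (p , q) → h (q , p)) (Adm.disjoint γ (inj₁ c))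
  sets-disjoint (inj₂ γ) (inj₁ c) x≢y = Adm.disjoint γ (inj₁ c)
  sets-disjoint (inj₂ γ) (inj₂ δ) x≢y = stages-disjoint λ { refl → x≢y refl }

  Listed : 𝒫 ℕ → Set
  Listed a = ∃[ x ] a ≡ ⌊ sets x ⌋

  𝒜 : 𝒫 (𝒫 ℕ)
  𝒜 = ⌊ Listed ⌋

  sets∈𝒜 : ∀ x → ⌊ sets x ⌋ ∈ 𝒜
  sets∈𝒜 x = ⌊⌋-intro Listed (x , refl)

  𝒜-almostDisjoint : AlmostDisjoint 𝒜
  𝒜-almostDisjoint =
    (λ a a∈ → inf (⌊⌋-elim Listed a∈)) ,
    λ a b a∈ b∈ → fin (⌊⌋-elim Listed a∈) (⌊⌋-elim Listed b∈)
    where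
    inf : ∀ {a} → Listed a → Infinite a
    inf (x , refl) = ∃^∞-map (λ _ → ⌊⌋-intro (sets x)) (sets-inf x)
    fin : ∀ {a b} → Listed a → Listed b → a ≢ b → Finite (a ∩ b)
    fin (x , refl) (y , refl) a≢b = ∀^∞-map
      (λ m h m∈ → let (p , q) = Equivalence.to T-∧ m∈ in h (⌊⌋-elim (sets x) p , ⌊⌋-elim (sets y) q))
      (sets-disjoint x y λ { refl → a≢b refl })

  ⋃-any : ∀ {I : Set} (s : I → Sub) L m → m ∈ ⋃ (map (λ x → ⌊ s x ⌋) L) → Any (λ x → s x m) L
  ⋃-any s (x ∷ L) m m∈ with Equivalence.to T-∨ m∈
  ... | inj₁ mx = here (⌊⌋-elim (s x) mx)
  ... | inj₂ mL = there (⋃-any s L m mL)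

  any-⋃ : ∀ {I : Set} (s : I → Sub) L m → Any (λ x → s x m) L → m ∈ ⋃ (map (λ x → ⌊ s x ⌋) L)
  any-⋃ s (x ∷ L) m (here xm) = Equivalence.from T-∨ (inj₁ (⌊⌋-intro (s x) xm))
  any-⋃ s (x ∷ L) m (there a) = Equivalence.from (T-∨ {⌊ s x ⌋ m}) (inj₂ (any-⋃ s L m a))

  -- The sequence is treated at the stage of its own code, since positivity for the whole family
  -- implies positivity for the earlier part.
  𝒜-tight : (b : ℕ → 𝒫 ℕ) → (∀ n → ℐ⁺ 𝒜 (b n)) →
            ∃[ a ] a ∈ 𝒜 × ∃^∞ (λ n → Infinite (b n ∩ a))
  𝒜-tight b positive = ⌊ set (stages δ) ⌋ , sets∈𝒜 (inj₂ δ) ,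
    ∃^∞-map (λ n → ∃^∞-map λ m (mb , ms) → Equivalence.from T-∧ (mb , ⌊⌋-intro (set (stages δ)) ms))
      (subst (λ b → (∀ n → Positive (_∈ b n)) → ∃^∞ (λ n → Inf (λ m → m ∈ b n × set (stages δ) m)))
             (decode-encode b) (proj₂ (spec δ)) still-positive)
    where
    δ = encode b
    open Family column (earlier δ)
    still-positive : ∀ n → Positive (_∈ b n)
    still-positive n L = ¬∀^∞¬⇒∃^∞ λ fin → positive n
      ( map (λ x → ⌊ mem x ⌋) L , members L
      , ∀^∞-map (λ m h m∈ → let (mb , m∉) = Equivalence.to (T-∧ {b n m}) m∈ in
                            h (mb , λ a → T-not⇒¬T m∉ (any-⋃ mem L m a))) fin )
      where
      member : ∀ x → ⌊ mem x ⌋ ∈ 𝒜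
      member (inj₁ c)       = sets∈𝒜 (inj₁ c)
      member (inj₂ (γ , _)) = sets∈𝒜 (inj₂ γ)
      members : ∀ L → All (_∈ 𝒜) (map (λ x → ⌊ mem x ⌋) L)
      members []      = []
      members (x ∷ L) = member x ∷ members L

  -- Distinct codes give infinite sets with finite intersection, so `𝒫 ℕ` injects into its subset
  -- `𝒜`.
  𝒜-size : ⟦ 𝒜 ⟧ ↔ 𝒫 ℕ
  𝒜-size = Bernstein.bijection em 𝒜 (λ γ → ⌊ set (stages γ) ⌋) injective (λ γ → sets∈𝒜 (inj₂ γ))
    where
    injective : ∀ {γ δ} → ⌊ set (stages γ) ⌋ ≡ ⌊ set (stages δ) ⌋ → γ ≡ δ
    injective {γ} {δ} eq = by-contradiction λ γ≢δ →
      let (m , _ , γm , h) = ∃^∞-∀^∞ (Adm.infinite γ) (stages-disjoint γ≢δ) 0 in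
      h (γm , ⌊⌋-elim (set (stages δ)) (subst (m ∈_) eq (⌊⌋-intro (set (stages γ)) γm)))

  weaklyTight : WeaklyTightOfSize𝔠
  weaklyTight = 𝒜 , (𝒜-almostDisjoint , 𝒜-tight) , 𝒜-size

-- Cardinals as well-orders; uncountable sets.

↣-trans : {A B C : Set} → A ↣ B → B ↣ C → A ↣ C
↣-trans f g = mk↣ {to = λ x → Injection.to g (Injection.to f x)}
                  (λ eq → Injection.injective f (Injection.injective g eq))

cardinalOrder : (κ : Cardinal) → WellOrder (Carrier κ)
cardinalOrder κ = record
  { _≺_ = Cardinal._<_ κ ; ≺-trans = STO.trans ; compare = cmp ; wf = Cardinal.wellFounded κ }
  where
  module STO = IsStrictTotalOrder (Cardinal.isStrictTotalOrder κ)
  cmp : ∀ x y → Cardinal._<_ κ x y ⊎ x ≡ y ⊎ Cardinal._<_ κ y x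
  cmp x y with STO.compare x y
  ... | tri< p _ _ = inj₁ p
  ... | tri≈ _ p _ = inj₂ (inj₁ p)
  ... | tri> _ _ p = inj₂ (inj₂ p)

module Infinitude (em : ∀ {P : Set} → Dec P) {S : Set} (uncountable : ¬ (S ↣ ℕ)) where
  open WithEM em

  _∈ˡ_ : S → List S → Set
  x ∈ˡ L = Any (x ≡_) L

  fresh : ∀ L → ∃[ x ] ¬ (x ∈ˡ L)
  fresh L = by-contradiction λ none → uncountable (mk↣ {to = λ x → toℕ (Any.index (mem none x))} λ {x} {y} eq →
    trans (lookup-index (mem none x)) (trans (cong (lookup L) (toℕ-injective eq)) (sym (lookup-index (mem none y)))))
    where
    mem : ¬ (∃[ x ] ¬ (x ∈ˡ L)) → ∀ x → x ∈ˡ L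
    mem none x = by-contradiction λ x∉L → none (x , x∉L)

  chosen : ℕ → List S
  chosen zero    = []
  chosen (suc n) = proj₁ (fresh (chosen n)) ∷ chosen n

  point : ℕ → S
  point n = proj₁ (fresh (chosen n))

  point∈chosen : ∀ {m n} → m < n → point m ∈ˡ chosen n
  point∈chosen {m} {suc n} m<1+n with m≤n⇒m<n∨m≡n (s≤s⁻¹ m<1+n)
  ... | inj₁ m<n  = there (point∈chosen m<n)
  ... | inj₂ refl = here refl

  point-≢ : ∀ {m n} → m < n → point m ≢ point n
  point-≢ {m} {n} m<n eq = proj₂ (fresh (chosen n)) (subst (_∈ˡ chosen n) eq (point∈chosen m<n))

  infinite : ℕ ↣ S
  infinite = mk↣ {to = point} injective
    where
    injective : ∀ {m n} → point m ≡ point n → m ≡ n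
    injective {m} {n} eq with <-cmp m n
    ... | tri< m<n _ _ = ⊥-elim (point-≢ m<n eq)
    ... | tri≈ _ m≡n _ = m≡n
    ... | tri> _ _ n<m = ⊥-elim (point-≢ n<m (sym eq))

-- Small initial segments from the cardinal hypotheses.

module WeaklyTightFamilies (classical : Classical) where

  em₁ : ∀ {P : Set₁} → Dec P
  em₁ = Classical.excludedMiddle classical

  em : ∀ {P : Set} → Dec P
  em {P} = map′ lower lift (em₁ {Lift (lsuc 0ℓ) P})

  ext : Extensionality 0ℓ 0ℓ
  ext = lower-extensionality (lsuc 0ℓ) (lsuc 0ℓ) (Classical.extensionality classical)

  ext₁ : Extensionality 0ℓ (lsuc 0ℓ)
  ext₁ = lower-extensionality (lsuc 0ℓ) 0ℓ (Classical.extensionality classical)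

  open WithEM em
  open Sets em ext

  SmallSegments : Cardinal → Set
  SmallSegments κ = ∀ α → Small (λ β → Cardinal._<_ κ β α)

  fromSplitting : ∀ κ → Is𝔰 κ → SmallSegments κ → WeaklyTightOfSize𝔠
  fromSplitting κ ((F , (_ , F-splits) , iso) , _) seg = conclude em
    where
    O = cardinalOrder κ
    e : Carrier κ → Sub
    e i n = n ∈ proj₁ (Inverse.from iso i)
    splitting : ∀ x → Inf x → ∃ (Splits e x)
    splitting x x-inf =
      let (a , a∈F , in-inf , out-inf) = F-splits ⌊ x ⌋ (∃^∞-map (λ _ → ⌊⌋-intro x) x-inf)
          i  = Inverse.to iso (a , a∈F)
          eq : a ≡ proj₁ (Inverse.from iso i)
          eq = cong proj₁ (sym (Inverse.strictlyInverseʳ iso (a , a∈F)))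
      in i , λ
        { true  → ∃^∞-map (λ m m∈ → let (xm , am) = Equivalence.to T-∧ m∈ in
                            ⌊⌋-elim x xm , subst (m ∈_) eq am) in-inf
        ; false → ∃^∞-map (λ m m∈ → let (xm , am) = Equivalence.to (T-∧ {⌊ x ⌋ m}) m∈ in
                            ⌊⌋-elim x xm , λ em → T-not⇒¬T am (subst (m ∈_) (sym eq) em)) out-inf }
    Unbdd : Set
    Unbdd = Σ (Carrier κ → ℕ → ℕ) λ f → ∀ g → ∃[ i ] ¬ (f i ≤* g)
    conclude : Dec Unbdd → WeaklyTightOfSize𝔠
    -- An unbounded family indexed by `κ` gives an (ω,ω)-splitting family indexed by pairs, whose
    -- segments Gödel's order keeps small.
    conclude (yes (f , unbounded)) =
      Construction.weaklyTight em em₁ ext ext₁ (Gödel.order O) blocks (Gödel.segment O seg) blocks-split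
      where open BlockSplitting em e splitting f unbounded
    conclude (no bounded) =
      Construction.weaklyTight em em₁ ext ext₁ O e seg (small-splitsω e small splitting)
      where
      small : Small {Carrier κ} (λ _ → ⊤)
      small f = by-contradiction λ none → bounded (f , λ g → ¬∀⇒∃¬ λ h → none (g , λ i _ → h i))

  -- An unbounded family indexed by the segment below `α` would have at least 𝔟 values, and these
  -- inject into the segment; so `κ` would inject below `α`.
  ≤𝔟⇒smallSegments : ∀ κ 𝔟 → Is𝔟 𝔟 → κ ≤ᶜ 𝔟 → SmallSegments κ
  ≤𝔟⇒smallSegments κ 𝔟 (_ , 𝔟-least) κ≤𝔟 α f = by-contradiction λ none →
    Cardinal.initial κ α (↣-trans κ≤𝔟 (↣-trans
      (𝔟-least ⌊ Value ⌋ λ { (g , h) → none (g , λ β β<α → h (f β) (⌊⌋-intro Value (β , β<α , refl))) })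
      (mk↣ {to = preimage} λ {x} {y} → preimage-injective x y)))
    where
    Value : (ℕ → ℕ) → Set
    Value h = ∃[ β ] β ∈ below κ α × f β ≡ h
    preimage : ⟦ ⌊ Value ⌋ ⟧ → ⟦ below κ α ⟧
    preimage (h , h∈) = let (β , β<α , _) = ⌊⌋-elim Value h∈ in β , β<α
    preimage-injective : ∀ x y → preimage x ≡ preimage y → x ≡ y
    preimage-injective (h , h∈) (k , k∈) eq = subset-≡ (trans
      (sym (proj₂ (proj₂ (⌊⌋-elim Value h∈)))) (trans (cong (f ∘ proj₁) eq) (proj₂ (proj₂ (⌊⌋-elim Value k∈)))))

  module _ (κ : Cardinal) where
    open Cardinal κ using (isStrictTotalOrder; wellFounded; initial) renaming (_<_ to _<κ_)
    private module STO = IsStrictTotalOrder isStrictTotalOrder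

    Countable : Carrier κ → Set
    Countable α = ⟦ below κ α ⟧ ↣ ℕ

    leastUncountable : ∀ α → ¬ Countable α → (∀ γ → γ <κ α → Countable γ) → Cardinal
    leastUncountable α uncountable below-countable = record
      { Carrier = ⟦ below κ α ⟧
      ; below   = λ (γ , _) (ζ , _) → below κ γ ζ
      ; isStrictTotalOrder = record
          { isStrictPartialOrder = record
              { isEquivalence = isEquivalence
              ; irrefl = λ { refl → STO.irrefl refl }
              ; trans  = STO.trans
              ; <-resp-≈ = (λ { refl → id }) , λ { refl → id } }
          ; compare = cmp }
      ; wellFounded = On.wellFounded proj₁ wellFounded
      ; initial = λ (γ , γ<α) inj → uncountable (↣-trans (↣-trans inj (forget γ)) (below-countable γ γ<α)) }
      where
      cmp : Trichotomous _≡_ (λ (x y : ⟦ below κ α ⟧) → proj₁ x <κ proj₁ y)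
      cmp (x , _) (y , _) with STO.compare x y
      ... | tri< p ¬q ¬r = tri< p (¬q ∘ cong proj₁) ¬r
      ... | tri≈ ¬p q ¬r = tri≈ ¬p (subset-≡ q) ¬r
      ... | tri> ¬p ¬q r = tri> ¬p (¬q ∘ cong proj₁) r
      forget : ∀ γ → ⟦ (λ ((ζ , _) : ⟦ below κ α ⟧) → below κ γ ζ) ⟧ ↣ ⟦ below κ γ ⟧
      forget γ = mk↣ {to = λ ((ζ , _) , ζ<γ) → ζ , ζ<γ} λ eq → subset-≡ (subset-≡ (cong proj₁ eq))

    -- Otherwise the least uncountable segment is itself a cardinal above ℵ₀, so `κ` would inject
    -- into one of its own proper segments.
    ℵ₁⇒countable : Isℵ 1 κ → ∀ α → Countable α
    ℵ₁⇒countable (μ , lift iso , _ , succ) α = by-contradiction λ unc →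
      let (β , uncountable , min) = least (cardinalOrder κ) (λ α → ¬ Countable α) (α , unc)
          ν = leastUncountable β uncountable λ γ γ<β → by-contradiction (min γ γ<β)
          μ↣ℕ = ↔⇒↣ iso
      in initial β (succ ν (↣-trans μ↣ℕ (Infinitude.infinite em uncountable) ,
                            λ ν≤μ → uncountable (↣-trans ν≤μ μ↣ℕ)))

    countable⇒smallSegments : (∀ α → Countable α) → SmallSegments κ
    countable⇒smallSegments countable α f =
      let (h , b) = countable-bound (λ n → value (em {Code n})) in
      h , λ β β<α → subst (_≤* h) (value-code β<α em) (b (ι (β , β<α)))
      where
      ι : ⟦ below κ α ⟧ → ℕ
      ι = Injection.to (countable α)
      Code : ℕ → Set
      Code n = ∃[ x ] ι x ≡ n
      value : ∀ {n} → Dec (Code n) → ℕ → ℕ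
      value (yes ((β , _) , _)) = f β
      value (no _)              = λ _ → 0
      value-code : ∀ {β} (β<α : β ∈ below κ α) (D : Dec (Code (ι (β , β<α)))) → value D ≡ f β
      value-code β<α (yes (x , eq)) = cong (f ∘ proj₁) (Injection.injective (countable α) eq)
      value-code β<α (no none)      = ⊥-elim (none (_ , refl))

theorem16 :
  Classical →
    (∀ κ → Is𝔰 κ → Is𝔟 κ → P κ → WeaklyTightOfSize𝔠)
    × (∀ 𝔰 𝔟 ℵω → Is𝔰 𝔰 → Is𝔟 𝔟 → Isℵω ℵω →
         𝔰 ≤ᶜ 𝔟 → 𝔟 <ᶜ ℵω → WeaklyTightOfSize𝔠)
    × (∀ 𝔰 → Is𝔰 𝔰 → Isℵ 1 𝔰 → WeaklyTightOfSize𝔠)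
theorem16 classical =
  (λ κ is𝔰 is𝔟 _ → fromSplitting κ is𝔰 (≤𝔟⇒smallSegments κ κ is𝔟 (mk↣ {to = id} id))) ,
  (λ 𝔰 𝔟 _ is𝔰 is𝔟 _ 𝔰≤𝔟 _ → fromSplitting 𝔰 is𝔰 (≤𝔟⇒smallSegments 𝔰 𝔟 is𝔟 𝔰≤𝔟)) ,
  (λ 𝔰 is𝔰 isℵ₁ → fromSplitting 𝔰 is𝔰 (countable⇒smallSegments 𝔰 (ℵ₁⇒countable 𝔰 isℵ₁)))
  where open WeaklyTightFamilies classical
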